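{- There is no connected $k$-regular graph on $n$ vertices with adjacency spectrum $\{[k]^1,[-1]^1,[\alpha]^{m},[\beta]^{n-2-m}\}$, where $k,-1,\alpha,\beta$ are pairwise distinct, $\alpha$ and $\beta$ are integers, and $2\leq m\leq n-4$.
   Context: Graphs are finite, simple and undirected; spectra are adjacency spectra, $[\lambda]^m$ denoting eigenvalue $\lambda$ with multiplicity $m$. -}

module Defs where

open import Data.Nat using (ℕ; zero; suc)
open import Data.Integer using (ℤ; +_; -_; _+_; _-_; _*_; _^_)
open import Data.Fin using (Fin; zero; suc; punchIn; _≟_)
open import Data.Bool using (Bool; true; false; if_then_else_)
open import Relation.Nullary using (¬_; does)
open import Relation.Binary.PropositionalEquality using (_≡_)

record Graph (n : ℕ) : Set where
  field
    adj       : Fin n → Fin n → Bool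
    symmetric : ∀ i j → adj i j ≡ adj j i
    loopless  : ∀ i → adj i i ≡ false
open Graph public

Σℤ : (n : ℕ) → (Fin n → ℤ) → ℤ
Σℤ zero    f = + 0
Σℤ (suc n) f = f zero + Σℤ n (λ i → f (suc i))

Matrix : ℕ → Set
Matrix n = Fin n → Fin n → ℤ

det : (n : ℕ) → Matrix n → ℤ
det zero    M = + 1
det (suc n) M = go n M
  where
  sign : ∀ {m} → Fin m → ℤ
  sign zero    = + 1
  sign (suc j) = - sign j
  go : (n : ℕ) → Matrix (suc n) → ℤ
  go n M = Σℤ (suc n) (λ j → sign j * M zero j * det n (λ r c → M (suc r) (punchIn j c)))

A : ∀ {n} → Graph n → Matrix n
A G i j = if adj G i j then + 1 else + 0

charPoly : ∀ {n} → Graph n → ℤ → ℤ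
charPoly {n} G x = det n (λ i j → (if does (i ≟ j) then x else + 0) - A G i j)

degree : ∀ {n} → Graph n → Fin n → ℤ
degree {n} G i = Σℤ n (A G i)

Regular : ∀ {n} → ℕ → Graph n → Set
Regular {n} k G = ∀ i → degree G i ≡ + k

data Reach {n} (G : Graph n) : Fin n → Fin n → Set where
  here : ∀ {i} → Reach G i i
  step : ∀ {i j l} → adj G i j ≡ true → Reach G j l → Reach G i l

Connected : ∀ {n} → Graph n → Set
Connected {n} G = ∀ (i j : Fin n) → Reach G i j

-- The adjacency spectrum of G is the multiset {[k]^1, [-1]^1, [α]^m, [β]^(n-2-m)}:
-- the characteristic polynomial equals (x-k)(x+1)(x-α)^m(x-β)^(n-2-m)
-- (equality as integer polynomials, i.e. at every integer x).
HasSpectrum : ∀ {n} → Graph n → ℤ → ℤ → ℤ → ℕ → ℕ → Set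
HasSpectrum G k α β m r =
  ∀ (x : ℤ) → charPoly G x ≡ (x - k) * (x + + 1) * ((x - α) ^ m) * ((x - β) ^ r)

{-# OPTIONS --safe #-}
module Submission where

-- Write B = A + 1, K = k + 1, a = α + 1, b = β + 1, and C = (A - α)(A - β). The characteristic polynomial
-- and the symmetry of A give (A - k)(A + 1) C = 0, and connectedness turns this into (A + 1) C = c J.
-- The matrix D = K C - c J is K a b times the projection to the (-1)-eigenspace and has constant diagonal δ₀.
-- As -1 is a simple root, det(x - A) is not divisible by (x + 1)², so some minor of -1 - A is nonzero,
-- which forces some row of D to have entries ±δ₀ only, with n δ₀ = K a b. A neighbour with sign +
-- gives ab ≤ 0 and -ab < k, a vertex with sign - gives n | 2ab, hence n = -2ab. With q = αβ ≤ 0 the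
-- trace identity for D then reads (k + 1)(k + ab) = q (n - k - 1): a positive number equal to a nonpositive one.

-- Everything happens over the integers, and the spectrum is known only through the values of a
-- polynomial at integers. Eigenvectors and diagonalisation are therefore replaced by integer
-- vectors and polynomials in A. An integer vector that lies in the image of A - x for every integer
-- x vanishes, which turns the values of the polynomial into a relation for A. The exponents of A -
-- α and A - β then disappear, because a symmetric M with M²v = 0 has Mv = 0. On the all-one vector
-- and on the (-1)-eigenspace, C acts by (k - α)(k - β) and ab, and it is zero on the rest. So C =
-- (c/K) J + ab P with P the projection to the (-1)-eigenspace, and the factor K in D clears the
-- denominator. A nonzero minor at i means that a vector in the kernel of A + 1 vanishes once its
-- i-th entry does. Hence the rows of D are proportional, and symmetry with constant diagonal gives
-- D_ij² = D_ii D_jj = δ₀². The bounds on ab come from counting: C = A² - (α + β)A + αβ has diagonal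
-- k + αβ, and an entry of A² at an edge is a number of common neighbours.

open import Defs
open import Data.Bool using (true; false; if_then_else_)
open import Data.Empty using (⊥)
open import Data.Fin as Fin using (Fin; zero; suc; punchIn; punchOut; inject₁; _≟_; toℕ; fromℕ<)
open import Data.Fin.Induction using (<-weakInduction)
open import Data.Fin.Properties using (punchInᵢ≢i; punchIn-punchOut; punchIn-injective; toℕ-inject₁; toℕ-fromℕ<; toℕ-injective; toℕ<n; <-cmp; suc-injective; ¬∀⟶∃¬)
open import Data.Integer using (ℤ; +_; -[1+_]; -_; _+_; _-_; _*_; _^_; ∣_∣; _≤_; _<_; +≤+; -≤+; +<+; nonNegative)
open import Data.Integer.Divisibility.Signed using (_∣_; divides; ∣⇒∣ᵤ; ∣m∣n⇒∣m+n; ∣m∣n⇒∣m-n; ∣m⇒∣m*n; ∣n⇒∣m*n; *-monoʳ-∣; *-cancelˡ-∣)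
open import Data.Integer.Properties hiding (<-cmp) renaming (_≟_ to _≟ℤ_)
open import Data.Integer.Tactic.RingSolver using (solve-∀)
open import Data.List using (List; [])
open import Data.Maybe using (nothing)
open import Data.Nat as ℕ using (ℕ; zero; suc)
import Data.Nat.Divisibility as ℕ
import Data.Nat.Properties as ℕ
open import Data.Product using (_×_; _,_; ∃; proj₁; proj₂)
open import Data.Sum using (_⊎_; inj₁; inj₂; reduce)
open import Function using (_∘_; id)
open import Level using (0ℓ)
open import Relation.Binary using (tri<; tri≈; tri>)
open import Relation.Binary.PropositionalEquality
open import Relation.Nullary using (¬_; does; yes; no; contradiction)
open import Relation.Nullary.Decidable using (dec-true; dec-false)
open import Tactic.RingSolver using (solve)
open import Tactic.RingSolver.Core.AlmostCommutativeRing using (AlmostCommutativeRing)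

-- The signs in the Laplace expansion

-- The sign function in the definition of det is local and cannot be named, and unification cannot
-- recover it from a product. The ring solver parses a goal syntactically, so over the following trivial
-- "ring", whose equality proofs carry an integer that every law passes on from the left, its proof
-- of x ≈ x for a product x carries the leftmost factor of x.
record Atom (x y : ℤ) : Set where
  constructor atom
  field value : ℤ
open Atom

leftmost : AlmostCommutativeRing 0ℓ 0ℓ
leftmost = record
  { Carrier = ℤ
  ; _≈_     = Atom
  ; _+_     = _+_
  ; _*_     = _*_
  ; -_      = -_
  ; 0#      = + 0
  ; 0≟_     = λ _ → nothing
  ; 1#      = + 1
  ; isAlmostCommutativeRing = record
    { isCommutativeSemiring = record
      { isSemiring = record
        { isSemiringWithoutAnnihilatingZero = record
          { +-isCommutativeMonoid = record
            { isMonoid = record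
              { isSemigroup = record
                { isMagma = record
                  { isEquivalence = record
                    { refl  = λ {x} → atom x
                    ; sym   = λ p → atom (value p)
                    ; trans = λ _ q → atom (value q)
                    }
                  ; ∙-cong = λ p _ → atom (value p)
                  }
                ; assoc = λ x _ _ → atom x
                }
              ; identity = (λ x → atom x) , (λ x → atom x)
              }
            ; comm = λ x _ → atom x
            }
          ; *-cong = λ p _ → atom (value p)
          ; *-assoc = λ x _ _ → atom x
          ; *-identity = (λ x → atom x) , (λ x → atom x)
          ; distrib = (λ x _ _ → atom x) , (λ x _ _ → atom x)
          }
        ; zero = (λ x → atom x) , (λ x → atom x)
        }
      ; *-comm = λ x _ → atom x
      }
    ; -‿cong = λ p → atom (value p)
    ; -‿*-distribˡ = λ x _ → atom x
    ; -‿+-comm = λ x _ → atom x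
    }
  }

noVariables : List ℤ
noVariables = []

Σ-cong : ∀ n {f g : Fin n → ℤ} → (∀ i → f i ≡ g i) → Σℤ n f ≡ Σℤ n g
Σ-cong zero    h = refl
Σ-cong (suc n) h = cong₂ _+_ (h zero) (Σ-cong n (λ i → h (suc i)))

sgn : ∀ {m} → Fin m → ℤ
sgn zero    = + 1
sgn (suc j) = - sgn j

minor : ∀ {n} → Matrix (suc n) → Fin (suc n) → Matrix n
minor M j r c = M (suc r) (punchIn j c)

-- The equation is supplied as `refl`, so that unification reads the summand `f` off the unfolded
-- determinant; the leftmost factor of `f i` is then the local sign.
tailAtoms : ∀ {n d h} (f : Fin n → ℤ) → d ≡ h + Σℤ n f → (∀ i → Atom (f i) (f i)) → Fin n → ℤ
tailAtoms _ _ a i = value (a i)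

tailSign : ∀ n → Matrix (suc n) → Fin n → ℤ
tailSign n M = tailAtoms {d = det (suc n) M} {h = + 1 * M zero zero * det n (minor M zero)} _ refl (λ i → solve noVariables leftmost)

-- The local sign function ignores M, so its values for M and for the zero matrix are definitionally equal.
tailSign≡-sgn : ∀ n M i → tailSign n M i ≡ - sgn i
tailSign≡-sgn (suc n) M zero    = refl
tailSign≡-sgn (suc n) M (suc i) = cong -_ (tailSign≡-sgn n (λ _ _ → + 0) i)

laplace : ∀ {n} → Matrix (suc n) → Fin (suc n) → ℤ
laplace {n} M j = sgn j * M zero j * det n (minor M j)

det-expand : ∀ n (M : Matrix (suc n)) → det (suc n) M ≡ Σℤ (suc n) (laplace M)
det-expand n M = cong (λ t → laplace M zero + t)
  (Σ-cong n (λ i → cong (λ s → s * M zero (suc i) * det n (minor M (suc i))) (tailSign≡-sgn n M i)))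

-- Determinants

Vector : ℕ → Set
Vector n = Fin n → ℤ

Σ-zero : ∀ n {f : Vector n} → (∀ i → f i ≡ + 0) → Σℤ n f ≡ + 0
Σ-zero zero    _ = refl
Σ-zero (suc n) h = cong₂ _+_ (h zero) (Σ-zero n (h ∘ suc))

Σ-single : ∀ n (f : Vector n) i → (∀ j → j ≢ i → f j ≡ + 0) → Σℤ n f ≡ f i
Σ-single (suc n) f zero    h = trans (cong (λ t → f zero + t) (Σ-zero n (λ j → h (suc j) (λ ())))) (+-identityʳ _)
Σ-single (suc n) f (suc i) h =
  trans (cong₂ _+_ (h zero (λ ())) (Σ-single n (f ∘ suc) i (λ j j≢i → h (suc j) (j≢i ∘ suc-injective)))) (+-identityˡ _)

private
  interchange : ∀ a b c x y → (a + c * b) + (x + c * y) ≡ (a + x) + c * (b + y)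
  interchange = solve-∀

Σ-linear : ∀ n c (f g : Vector n) → Σℤ n (λ i → f i + c * g i) ≡ Σℤ n f + c * Σℤ n g
Σ-linear zero    c f g = sym (trans (+-identityˡ _) (*-zeroʳ c))
Σ-linear (suc n) c f g =
  trans (cong (λ t → f zero + c * g zero + t) (Σ-linear n c (f ∘ suc) (g ∘ suc))) (interchange (f zero) (g zero) c _ _)

Σ-adjacent : ∀ n (f : Vector (suc n)) (p : Fin n) → (∀ j → j ≢ inject₁ p → j ≢ suc p → f j ≡ + 0) →
             f (inject₁ p) + f (suc p) ≡ + 0 → Σℤ (suc n) f ≡ + 0
Σ-adjacent (suc n) f zero h pair = begin
  f zero + (f (suc zero) + Σℤ n _) ≡⟨ cong (λ t → f zero + (f (suc zero) + t)) (Σ-zero n (λ j → h (suc (suc j)) (λ ()) (λ ()))) ⟩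
  f zero + (f (suc zero) + + 0)    ≡⟨ cong (λ t → f zero + t) (+-identityʳ _) ⟩
  f zero + f (suc zero)            ≡⟨ pair ⟩
  + 0                              ∎
  where open ≡-Reasoning
Σ-adjacent (suc n) f (suc p) h pair =
  cong₂ _+_ (h zero (λ ()) (λ ()))
    (Σ-adjacent n (f ∘ suc) p (λ j a b → h (suc j) (a ∘ suc-injective) (b ∘ suc-injective)) pair)

det-cong : ∀ n {M N : Matrix n} → (∀ r c → M r c ≡ N r c) → det n M ≡ det n N
det-cong zero    h = refl
det-cong (suc n) {M} {N} h = begin
  det (suc n) M ≡⟨ det-expand n M ⟩
  Σℤ (suc n) (laplace M) ≡⟨ Σ-cong (suc n) (λ j → cong₂ (λ a d → sgn j * a * d) (h zero j) (det-cong n (λ r c → h (suc r) (punchIn j c)))) ⟩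
  Σℤ (suc n) (laplace N) ≡⟨ det-expand n N ⟨
  det (suc n) N ∎
  where open ≡-Reasoning

private
  entry-linear : ∀ s m k c d → s * (m + c * k) * d ≡ s * m * d + c * (s * k * d)
  entry-linear = solve-∀
  minor-linear : ∀ s m c d e → s * m * (d + c * e) ≡ s * m * d + c * (s * m * e)
  minor-linear = solve-∀

AgreeOff : ∀ {n} → Fin n → Matrix n → Matrix n → Set
AgreeOff p M N = ∀ r c → c ≢ p → M r c ≡ N r c

-- In the Laplace expansion the term of column `p` is linear through its entry, and every other term
-- through its minor, in which column `p` sits at `punchOut j≢p`.
det-linear : ∀ n {L M N : Matrix n} x p → AgreeOff p L M → AgreeOff p L N →
             (∀ r → L r p ≡ M r p + x * N r p) → det n L ≡ det n M + x * det n N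
det-linear (suc n) {L} {M} {N} x p LM LN Lp = begin
  det (suc n) L                                ≡⟨ det-expand n L ⟩
  Σℤ (suc n) (laplace L)                          ≡⟨ Σ-cong (suc n) split ⟩
  Σℤ (suc n) (λ j → laplace M j + x * laplace N j)   ≡⟨ Σ-linear (suc n) x (laplace M) (laplace N) ⟩
  Σℤ (suc n) (laplace M) + x * Σℤ (suc n) (laplace N) ≡⟨ cong₂ (λ a b → a + x * b) (det-expand n M) (det-expand n N) ⟨
  det (suc n) M + x * det (suc n) N            ∎
  where
  open ≡-Reasoning
  split : ∀ j → laplace L j ≡ laplace M j + x * laplace N j
  split j with j ≟ p
  ... | yes refl = begin
    sgn j * L zero j * det n (minor L j)                     ≡⟨ cong (λ t → sgn j * t * det n (minor L j)) (Lp zero) ⟩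
    sgn j * (M zero j + x * N zero j) * det n (minor L j)    ≡⟨ entry-linear (sgn j) (M zero j) (N zero j) x (det n (minor L j)) ⟩
    sgn j * M zero j * det n (minor L j) + x * (sgn j * N zero j * det n (minor L j))
      ≡⟨ cong₂ (λ a b → sgn j * M zero j * a + x * (sgn j * N zero j * b))
           (det-cong n (λ r c → LM (suc r) _ (punchInᵢ≢i j c))) (det-cong n (λ r c → LN (suc r) _ (punchInᵢ≢i j c))) ⟩
    laplace M j + x * laplace N j                                  ∎
  ... | no j≢p = begin
    sgn j * L zero j * det n (minor L j)
      ≡⟨ cong (sgn j * L zero j *_) (det-linear n x (punchOut j≢p) (off LM) (off LN) at) ⟩
    sgn j * L zero j * (det n (minor M j) + x * det n (minor N j))
      ≡⟨ minor-linear (sgn j) (L zero j) x (det n (minor M j)) (det n (minor N j)) ⟩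
    sgn j * L zero j * det n (minor M j) + x * (sgn j * L zero j * det n (minor N j))
      ≡⟨ cong₂ (λ a b → sgn j * a * det n (minor M j) + x * (sgn j * b * det n (minor N j))) (LM zero j j≢p) (LN zero j j≢p) ⟩
    laplace M j + x * laplace N j ∎
    where
    off : ∀ {K} → AgreeOff p L K → AgreeOff (punchOut j≢p) (minor L j) (minor K j)
    off LK r c c≢ = LK (suc r) (punchIn j c) λ eq →
      c≢ (punchIn-injective j c (punchOut j≢p) (trans eq (sym (punchIn-punchOut j≢p))))
    at : ∀ r → minor L j r (punchOut j≢p) ≡ minor M j r (punchOut j≢p) + x * minor N j r (punchOut j≢p)
    at r rewrite punchIn-punchOut j≢p = Lp (suc r)

-- For the expansion of a matrix with two equal adjacent columns: a minor that keeps both of them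
-- has two equal adjacent columns again.
punchIn-adjacent : ∀ {n} (p : Fin (suc n)) j → j ≢ inject₁ p → j ≢ suc p →
                   ∃ λ q → punchIn j (inject₁ q) ≡ inject₁ p × punchIn j (suc q) ≡ suc p
punchIn-adjacent zero zero          a _ = contradiction refl a
punchIn-adjacent zero (suc zero)    _ b = contradiction refl b
punchIn-adjacent {suc n} zero (suc (suc j)) _ _ = zero , refl , refl
punchIn-adjacent {suc n} (suc p) zero _ _ = p , refl , refl
punchIn-adjacent {suc n} (suc p) (suc j) a b
  with q , e , e′ ← punchIn-adjacent p j (a ∘ cong suc) (b ∘ cong suc) = suc q , cong suc e , cong suc e′

-- Compares the minors at two adjacent columns: they use the same column in every position but one,
-- where each uses the column that the other deletes.
punchIn-inject₁-suc : ∀ {n} (p c : Fin n) → punchIn (inject₁ p) c ≡ punchIn (suc p) c ⊎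
                      (punchIn (inject₁ p) c ≡ suc p × punchIn (suc p) c ≡ inject₁ p)
punchIn-inject₁-suc zero    zero    = inj₂ (refl , refl)
punchIn-inject₁-suc zero    (suc c) = inj₁ refl
punchIn-inject₁-suc (suc p) zero    = inj₁ refl
punchIn-inject₁-suc (suc p) (suc c) with punchIn-inject₁-suc p c
... | inj₁ e        = inj₁ (cong suc e)
... | inj₂ (e , e′) = inj₂ (cong suc e , cong suc e′)

sgn-inject₁ : ∀ {n} (p : Fin n) → sgn (inject₁ p) ≡ sgn p
sgn-inject₁ zero    = refl
sgn-inject₁ (suc p) = cong -_ (sgn-inject₁ p)

private
  opposite-terms : ∀ s m d → s * m * d + - s * m * d ≡ + 0
  opposite-terms = solve-∀

-- Terms outside the pair vanish by induction on the size. The two terms of the pair have equal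
-- entries, equal minors and opposite signs.
det-adjacent : ∀ n (M : Matrix (suc n)) p → (∀ r → M r (inject₁ p) ≡ M r (suc p)) → det (suc n) M ≡ + 0
det-adjacent (suc n) M p eq = trans (det-expand (suc n) M) (Σ-adjacent (suc n) (laplace M) p others pair)
  where
  others : ∀ j → j ≢ inject₁ p → j ≢ suc p → sgn j * M zero j * det (suc n) (minor M j) ≡ + 0
  others j a b with q , e , e′ ← punchIn-adjacent p j a b =
    trans (cong (sgn j * M zero j *_) (det-adjacent n (minor M j) q equal)) (*-zeroʳ (sgn j * M zero j))
    where
    equal : ∀ r → minor M j r (inject₁ q) ≡ minor M j r (suc q)
    equal r rewrite e | e′ = eq (suc r)
  minors : ∀ r c → minor M (inject₁ p) r c ≡ minor M (suc p) r c
  minors r c with punchIn-inject₁-suc p c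
  ... | inj₁ e        = cong (M (suc r)) e
  ... | inj₂ (e , e′) = trans (cong (M (suc r)) e) (trans (sym (eq (suc r))) (cong (M (suc r)) (sym e′)))
  pair : sgn (inject₁ p) * M zero (inject₁ p) * det (suc n) (minor M (inject₁ p)) + - sgn p * M zero (suc p) * det (suc n) (minor M (suc p)) ≡ + 0
  pair rewrite sgn-inject₁ p | eq zero | det-cong (suc n) minors = opposite-terms (sgn p) (M zero (suc p)) _

infixl 10 _[_←_]

_[_←_] : ∀ {n} → Matrix n → Fin n → Vector n → Matrix n
(M [ p ← w ]) r c = if does (c ≟ p) then w r else M r c

set-at : ∀ {n} (M : Matrix n) p w r → (M [ p ← w ]) r p ≡ w r
set-at M p w r rewrite dec-true (p ≟ p) refl = refl

set-off : ∀ {n} (M : Matrix n) p w r {c} → c ≢ p → (M [ p ← w ]) r c ≡ M r c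
set-off M p w r {c} c≢p rewrite dec-false (c ≟ p) c≢p = refl

set-agree : ∀ {n} (M : Matrix n) p u w → AgreeOff p (M [ p ← u ]) (M [ p ← w ])
set-agree M p u w r c c≢p = trans (set-off M p u r c≢p) (sym (set-off M p w r c≢p))

set-id : ∀ {n} (M : Matrix n) p w → (∀ r → w r ≡ M r p) → ∀ r c → (M [ p ← w ]) r c ≡ M r c
set-id M p w h r c with c ≟ p
... | yes refl = h r
... | no _     = refl

det-set-linear : ∀ {n} (M : Matrix n) p x (u w : Vector n) →
                 det n (M [ p ← (λ r → u r + x * w r) ]) ≡ det n (M [ p ← u ]) + x * det n (M [ p ← w ])
det-set-linear M p x u w = det-linear _ x p (set-agree M p v u) (set-agree M p v w)
  (λ r → trans (set-at M p v r) (sym (cong₂ (λ a b → a + x * b) (set-at M p u r) (set-at M p w r))))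
  where
  v : Vector _
  v r = u r + x * w r

private
  antisym-from : ∀ a b c d → a ≡ + 0 → d ≡ + 0 → (a + + 1 * c) + + 1 * (b + + 1 * d) ≡ + 0 → c ≡ - b
  antisym-from _ b c _ refl refl h = i-j≡0⇒i≡j c (- b) (trans (shape b c) h)
    where
    shape : ∀ b c → c - - b ≡ (+ 0 + + 1 * c) + + 1 * (b + + 1 * + 0)
    shape = solve-∀

inject₁≢suc : ∀ {n} (p : Fin n) → inject₁ p ≢ suc p
inject₁≢suc (suc p) eq = inject₁≢suc p (suc-injective eq)

-- Polarisation: with u + w in both columns the determinant vanishes, and of its four terms the two
-- with a repeated vector vanish as well.
det-swap : ∀ {n} (M : Matrix (suc n)) p u w →
           det (suc n) (M [ inject₁ p ← u ] [ suc p ← w ]) ≡ - det (suc n) (M [ inject₁ p ← w ] [ suc p ← u ])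
det-swap {n} M p u w = antisym-from (G u u) (G w u) (G u w) (G w w) (equal u) (equal w) (begin
    (G u u + + 1 * G u w) + + 1 * (G w u + + 1 * G w w) ≡⟨ cong₂ (λ a b → a + + 1 * b) (right u) (right w) ⟨
    G u u+w + + 1 * G w u+w                             ≡⟨ left ⟨
    G u+w u+w                                           ≡⟨ equal u+w ⟩
    + 0                                                 ∎)
  where
  open ≡-Reasoning
  a b : Fin (suc n)
  a = inject₁ p
  b = suc p
  a≢b : a ≢ b
  a≢b = inject₁≢suc p
  H : Vector (suc n) → Vector (suc n) → Matrix (suc n)
  H x y = M [ a ← x ] [ b ← y ]
  G : Vector (suc n) → Vector (suc n) → ℤ
  G x y = det (suc n) (H x y)
  u+w : Vector (suc n)
  u+w r = u r + + 1 * w r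
  at-a : ∀ x y r → H x y r a ≡ x r
  at-a x y r = trans (set-off (M [ a ← x ]) b y r a≢b) (set-at M a x r)
  equal : ∀ x → G x x ≡ + 0
  equal x = det-adjacent n (H x x) p (λ r → trans (at-a x x r) (sym (set-at (M [ a ← x ]) b x r)))
  right : ∀ x → G x u+w ≡ G x u + + 1 * G x w
  right x = det-set-linear (M [ a ← x ]) b (+ 1) u w
  off : ∀ x y → AgreeOff a (H u+w y) (H x y)
  off x y r c c≢a with c ≟ b
  ... | yes _ = refl
  ... | no _  = set-agree M a u+w x r c c≢a
  left : G u+w u+w ≡ G u u+w + + 1 * G w u+w
  left = det-linear (suc n) (+ 1) a (off u u+w) (off w u+w)
    (λ r → trans (at-a u+w u+w r) (sym (cong₂ (λ x y → x + + 1 * y) (at-a u u+w r) (at-a w u+w r))))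

private
  SeparatedFrom : ∀ {n} → Fin (suc n) → Set
  SeparatedFrom {n} q = ∀ (M : Matrix (suc n)) p → p Fin.< q → (∀ r → M r p ≡ M r q) → det (suc n) M ≡ + 0

  -- Swaps with the left neighbour, each changing only the sign, move the right one of the two equal
  -- columns until they are adjacent.
  det-alternating-< : ∀ {n} (q : Fin (suc n)) → SeparatedFrom q
  det-alternating-< {n} = <-weakInduction SeparatedFrom (λ _ _ ()) climb
    where
    climb : ∀ i → SeparatedFrom (inject₁ i) → SeparatedFrom (suc i)
    climb i ih M p p<1+i eq with p ≟ inject₁ i
    ... | yes refl = det-adjacent n M i eq
    ... | no p≢a = begin
      det (suc n) M                                  ≡⟨ det-cong (suc n) id₂ ⟨
      det (suc n) (M [ a ← col a ] [ b ← col b ])    ≡⟨ det-swap M i (col a) (col b) ⟩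
      - det (suc n) (M [ a ← col b ] [ b ← col a ])  ≡⟨ cong -_ (ih (M [ a ← col b ] [ b ← col a ]) p p<a moved) ⟩
      + 0                                            ∎
      where
      open ≡-Reasoning
      a b : Fin (suc n)
      a = inject₁ i
      b = suc i
      col : Fin (suc n) → Vector (suc n)
      col c r = M r c
      p<a : p Fin.< a
      p<a = ℕ.≤∧≢⇒< (subst (toℕ p ℕ.≤_) (sym (toℕ-inject₁ i)) (ℕ.≤-pred p<1+i)) (p≢a ∘ toℕ-injective)
      p≢b : p ≢ b
      p≢b refl = ℕ.<-irrefl refl p<1+i
      id₂ : ∀ r c → (M [ a ← col a ] [ b ← col b ]) r c ≡ M r c
      id₂ r c with c ≟ b
      ... | yes refl = refl
      ... | no _     = set-id M a (col a) (λ _ → refl) r c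
      moved : ∀ r → (M [ a ← col b ] [ b ← col a ]) r p ≡ (M [ a ← col b ] [ b ← col a ]) r a
      moved r = begin
        (M [ a ← col b ] [ b ← col a ]) r p ≡⟨ set-off (M [ a ← col b ]) b (col a) r p≢b ⟩
        (M [ a ← col b ]) r p               ≡⟨ set-off M a (col b) r p≢a ⟩
        M r p                               ≡⟨ eq r ⟩
        M r b                               ≡⟨ set-at M a (col b) r ⟨
        (M [ a ← col b ]) r a               ≡⟨ set-off (M [ a ← col b ]) b (col a) r (inject₁≢suc i) ⟨
        (M [ a ← col b ] [ b ← col a ]) r a ∎

det-alternating : ∀ n (M : Matrix n) {p q} → p ≢ q → (∀ r → M r p ≡ M r q) → det n M ≡ + 0
det-alternating (suc n) M {p} {q} p≢q eq with <-cmp p q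
... | tri< p<q _ _ = det-alternating-< q M p p<q eq
... | tri≈ _ p≡q _ = contradiction p≡q p≢q
... | tri> _ _ q<p = det-alternating-< p M q q<p (λ r → sym (eq r))

private
  vanishes : ∀ d → d ≡ d + + 1 * d → d ≡ + 0
  vanishes d h = trans (trans (shape d) (cong (λ e → e - d) (sym h))) (+-inverseʳ d)
    where
    shape : ∀ d → d ≡ d + + 1 * d - d
    shape = solve-∀

-- Linearity with all three matrices equal to `M` reads d = d + d.
det-zero-column : ∀ n (M : Matrix n) p → (∀ r → M r p ≡ + 0) → det n M ≡ + 0
det-zero-column n M p h = vanishes (det n M) (det-linear n (+ 1) p (λ _ _ _ → refl) (λ _ _ _ → refl)
  (λ r → trans (h r) (sym (cong (λ t → t + + 1 * t) (h r)))))

private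
  reorder : ∀ a b s → a * b + s ≡ s + b * a
  reorder = solve-∀

det-set-Σ : ∀ {n} (M : Matrix n) p m (u : Fin m → Vector n) (v : Vector m) →
            det n (M [ p ← (λ r → Σℤ m (λ j → u j r * v j)) ]) ≡ Σℤ m (λ j → det n (M [ p ← u j ]) * v j)
det-set-Σ {n} M p zero    u v = det-zero-column n _ p (λ r → set-at M p (λ _ → + 0) r)
det-set-Σ {n} M p (suc m) u v = begin
  det n (M [ p ← (λ r → u zero r * v zero + rest r) ])
    ≡⟨ det-cong n (λ r c → cong (λ t → if does (c ≟ p) then t else M r c) (reorder (u zero r) (v zero) (rest r))) ⟩
  det n (M [ p ← (λ r → rest r + v zero * u zero r) ])
    ≡⟨ det-set-linear M p (v zero) rest (u zero) ⟩
  det n (M [ p ← rest ]) + v zero * det n (M [ p ← u zero ])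
    ≡⟨ cong (λ t → t + v zero * det n (M [ p ← u zero ])) (det-set-Σ M p m (u ∘ suc) (v ∘ suc)) ⟩
  Σℤ m (λ j → det n (M [ p ← u (suc j) ]) * v (suc j)) + v zero * det n (M [ p ← u zero ])
    ≡⟨ reorder (det n (M [ p ← u zero ])) (v zero) _ ⟨
  Σℤ (suc m) (λ j → det n (M [ p ← u j ]) * v j) ∎
  where
  open ≡-Reasoning
  rest : Vector n
  rest r = Σℤ m (λ j → u (suc j) r * v (suc j))

infixr 8 _∙_

_∙_ : ∀ {n} → Matrix n → Vector n → Vector n
_∙_ {n} M v r = Σℤ n (λ j → M r j * v j)

-- Expanding `M ∙ v` into the columns of `M` leaves only the term of the i-th column; every other
-- term repeats a column.
cramer : ∀ n (M : Matrix n) v i → det n (M [ i ← M ∙ v ]) ≡ det n M * v i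
cramer n M v i = begin
  det n (M [ i ← M ∙ v ])                                ≡⟨ det-set-Σ M i n (λ j r → M r j) v ⟩
  Σℤ n (λ j → det n (M [ i ← (λ r → M r j) ]) * v j)     ≡⟨ Σ-single n (λ j → det n (M [ i ← (λ r → M r j) ]) * v j) i others ⟩
  det n (M [ i ← (λ r → M r i) ]) * v i                  ≡⟨ cong (λ d → d * v i) (det-cong n (set-id M i (λ r → M r i) (λ _ → refl))) ⟩
  det n M * v i                                          ∎
  where
  open ≡-Reasoning
  others : ∀ j → j ≢ i → det n (M [ i ← (λ r → M r j) ]) * v j ≡ + 0
  others j j≢i = cong (λ d → d * v j) (det-alternating n (M [ i ← (λ r → M r j) ]) j≢i
    (λ r → trans (set-off M i (λ r → M r j) r j≢i) (sym (set-at M i (λ r → M r j) r))))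

-- Determinants modulo an integer

infix 4 _≡_[mod_]

_≡_[mod_] : ℤ → ℤ → ℤ → Set
x ≡ y [mod h ] = h ∣ x - y

private
  sum-shape : ∀ a b c d → (a + c) - (b + d) ≡ (a - b) + (c - d)
  sum-shape = solve-∀
  product-shape : ∀ a b c d → a * c - b * d ≡ (a - b) * c + b * (c - d)
  product-shape = solve-∀

mod-reflexive : ∀ {h x y} → x ≡ y → x ≡ y [mod h ]
mod-reflexive {h} {x} refl = subst (h ∣_) (sym (+-inverseʳ x)) (divides (+ 0) refl)

+-mod : ∀ {h} a b c d → a ≡ b [mod h ] → c ≡ d [mod h ] → a + c ≡ b + d [mod h ]
+-mod {h} a b c d p q = subst (h ∣_) (sym (sum-shape a b c d)) (∣m∣n⇒∣m+n p q)

*-mod : ∀ {h} a b c d → a ≡ b [mod h ] → c ≡ d [mod h ] → a * c ≡ b * d [mod h ]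
*-mod {h} a b c d p q = subst (h ∣_) (sym (product-shape a b c d)) (∣m∣n⇒∣m+n (∣m⇒∣m*n c p) (∣n⇒∣m*n b q))

Σ-mod : ∀ {h} n (f g : Vector n) → (∀ i → f i ≡ g i [mod h ]) → Σℤ n f ≡ Σℤ n g [mod h ]
Σ-mod zero    f g p = mod-reflexive {x = + 0} refl
Σ-mod (suc n) f g p = +-mod (f zero) (g zero) (Σℤ n (f ∘ suc)) (Σℤ n (g ∘ suc)) (p zero) (Σ-mod n (f ∘ suc) (g ∘ suc) (p ∘ suc))

det-mod : ∀ {h} n (M N : Matrix n) → (∀ r c → M r c ≡ N r c [mod h ]) → det n M ≡ det n N [mod h ]
det-mod zero    M N p = mod-reflexive {x = + 1} refl
det-mod {h} (suc n) M N p = subst₂ (λ a b → a ≡ b [mod h ]) (sym (det-expand n M)) (sym (det-expand n N))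
  (Σ-mod (suc n) (laplace M) (laplace N) λ j →
    *-mod (sgn j * M zero j) (sgn j * N zero j) (det n (minor M j)) (det n (minor N j))
      (*-mod (sgn j) (sgn j) (M zero j) (N zero j) (mod-reflexive {x = sgn j} refl) (p zero j))
      (det-mod n (minor M j) (minor N j) (λ r c → p (suc r) (punchIn j c))))

δ : ∀ {n} → Fin n → Fin n → ℤ
δ i j = if does (i ≟ j) then + 1 else + 0

private
  shift-shape : ∀ m h x → m + h * x - m ≡ x * h
  shift-shape = solve-∀
  no-shift-shape : ∀ m → m ≡ m + + 0
  no-shift-shape = solve-∀

-- Shifting the diagonal by h one column at a time; each step adds h times a principal minor, modulo h².
module _ {n} (h : ℤ) (M : Matrix n) (minors : ∀ i → det n (M [ i ← (λ r → δ r i) ]) ≡ + 0) where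

  private
    shifted : ℕ → Matrix n
    shifted t r c = M r c + (if toℕ c ℕ.<ᵇ t then h * δ r c else + 0)

    shifted≡M : ∀ t r c → shifted t r c ≡ M r c [mod h ]
    shifted≡M t r c with toℕ c ℕ.<ᵇ t
    ... | true  = divides (δ r c) (shift-shape (M r c) h (δ r c))
    ... | false = mod-reflexive {h} {M r c + + 0} (+-identityʳ _)

    shifted-step : ∀ p → det n (shifted (suc (toℕ p))) ≡ det n (shifted (toℕ p)) + h * det n (shifted (toℕ p) [ p ← (λ r → δ r p) ])
    shifted-step p = det-linear n h p old (λ r c c≢p → trans (old r c c≢p) (sym (set-off (shifted t) p (λ r → δ r p) r c≢p))) new
      where
      t : ℕ
      t = toℕ p
      old : AgreeOff p (shifted (suc t)) (shifted t)
      old r c c≢p with toℕ c ℕ.<? t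
      ... | yes <t rewrite dec-true (toℕ c ℕ.<? t) <t | dec-true (toℕ c ℕ.<? suc t) (ℕ.m<n⇒m<1+n <t) = refl
      ... | no ≮t rewrite dec-false (toℕ c ℕ.<? t) ≮t
        | dec-false (toℕ c ℕ.<? suc t) (λ <1+t → ≮t (ℕ.≤∧≢⇒< (ℕ.≤-pred <1+t) (c≢p ∘ toℕ-injective))) = refl
      new : ∀ r → shifted (suc t) r p ≡ shifted t r p + h * (shifted t [ p ← (λ r → δ r p) ]) r p
      new r = trans (cong (λ b → M r p + (if b then h * δ r p else + 0)) (dec-true (t ℕ.<? suc t) (ℕ.n<1+n t)))
        (trans (cong (λ m → m + h * δ r p) (no-shift-shape (M r p)))
          (sym (cong₂ (λ b x → M r p + (if b then h * δ r p else + 0) + h * x)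
            (dec-false (t ℕ.<? t) (ℕ.<-irrefl refl)) (set-at (shifted t) p (λ r → δ r p) r))))

    minor-mod : ∀ t p → h ∣ det n (shifted t [ p ← (λ r → δ r p) ])
    minor-mod t p = subst (h ∣_) (trans (cong (λ m → det n N - m) (minors p)) (+-identityʳ _)) (det-mod n N (M [ p ← (λ r → δ r p) ]) entry)
      where
      N : Matrix n
      N = shifted t [ p ← (λ r → δ r p) ]
      entry : ∀ r c → N r c ≡ (M [ p ← (λ r → δ r p) ]) r c [mod h ]
      entry r c with c ≟ p
      ... | yes _ = mod-reflexive {h} {δ r p} refl
      ... | no _  = shifted≡M t r c

    h²∣shifted : det n M ≡ + 0 → ∀ t → t ℕ.≤ n → h * h ∣ det n (shifted t)
    h²∣shifted d≡0 zero    _   = subst (h * h ∣_) (sym (trans (det-cong n (λ _ _ → +-identityʳ _)) d≡0)) (divides (+ 0) refl)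
    h²∣shifted d≡0 (suc t) t<n = subst (λ t → h * h ∣ det n (shifted (suc t))) (toℕ-fromℕ< t<n)
      (subst (h * h ∣_) (sym (shifted-step p)) (∣m∣n⇒∣m+n
        (subst (λ t → h * h ∣ det n (shifted t)) (sym (toℕ-fromℕ< t<n)) (h²∣shifted d≡0 t (ℕ.<⇒≤ t<n)))
        (*-monoʳ-∣ h (minor-mod (toℕ p) p))))
      where
      p : Fin n
      p = fromℕ< t<n

  h²∣det : det n M ≡ + 0 → h * h ∣ det n (λ r c → M r c + h * δ r c)
  h²∣det d≡0 = subst (h * h ∣_) (det-cong n full) (h²∣shifted d≡0 n ℕ.≤-refl)
    where
    full : ∀ r c → shifted n r c ≡ M r c + h * δ r c
    full r c rewrite dec-true (toℕ c ℕ.<? n) (toℕ<n c) = refl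

-- The adjugate, and vectors in the kernel of a matrix

δ-refl : ∀ {n} (i : Fin n) → δ i i ≡ + 1
δ-refl i rewrite dec-true (i ≟ i) refl = refl

δ-off : ∀ {n} {i j : Fin n} → i ≢ j → δ i j ≡ + 0
δ-off {i = i} {j} i≢j rewrite dec-false (i ≟ j) i≢j = refl

δ-sym : ∀ {n} (i j : Fin n) → δ i j ≡ δ j i
δ-sym i j with i ≟ j
... | yes refl = sym (δ-refl i)
... | no i≢j   = sym (δ-off (i≢j ∘ sym))

Σ-δ : ∀ {n} (v : Vector n) i → Σℤ n (λ j → v j * δ i j) ≡ v i
Σ-δ {n} v i = trans (Σ-single n (λ j → v j * δ i j) i (λ j j≢i → trans (cong (v j *_) (δ-off (j≢i ∘ sym))) (*-zeroʳ (v j))))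
  (trans (cong (v i *_) (δ-refl i)) (*-identityʳ (v i)))

-- This is adj(M) M = det(M) I, a cofactor being a determinant with a unit column. Summing the unit
-- columns puts column `l` of `M`, that is `M` applied to a unit vector, into column `i`, and
-- `cramer` applies.
adjugate-row : ∀ {n} (M : Matrix n) i l → Σℤ n (λ j → det n (M [ i ← (λ r → δ r j) ]) * M j l) ≡ det n M * δ i l
adjugate-row {n} M i l = begin
  Σℤ n (λ j → det n (M [ i ← (λ r → δ r j) ]) * M j l)
    ≡⟨ det-set-Σ M i n (λ j r → δ r j) (λ j → M j l) ⟨
  det n (M [ i ← (λ r → Σℤ n (λ j → δ r j * M j l)) ])
    ≡⟨ det-cong n (λ r c → cong (λ t → if does (c ≟ i) then t else M r c) (trans (columns₁ r) (sym (columns₂ r)))) ⟩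
  det n (M [ i ← M ∙ (λ j → δ j l) ])
    ≡⟨ cramer n M (λ j → δ j l) i ⟩
  det n M * δ i l ∎
  where
  open ≡-Reasoning
  columns₁ : ∀ r → Σℤ n (λ j → δ r j * M j l) ≡ M r l
  columns₁ r = trans (Σ-cong n (λ j → *-comm (δ r j) (M j l))) (Σ-δ (λ j → M j l) r)
  columns₂ : ∀ r → (M ∙ (λ j → δ j l)) r ≡ M r l
  columns₂ r = trans (Σ-cong n (λ j → cong (M r j *_) (δ-sym j l))) (Σ-δ (M r) l)

det-set-scale : ∀ {n} (M : Matrix n) p x w → det n (M [ p ← (λ r → x * w r) ]) ≡ x * det n (M [ p ← w ])
det-set-scale {n} M p x w = trans (det-linear n x p (set-agree M p xw (λ _ → + 0)) (set-agree M p xw w) at)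
  (trans (cong (_+ x * det n (M [ p ← w ])) (det-zero-column n (M [ p ← (λ _ → + 0) ]) p (set-at M p (λ _ → + 0)))) (+-identityˡ _))
  where
  xw : Vector n
  xw r = x * w r
  at : ∀ r → (M [ p ← xw ]) r p ≡ (M [ p ← (λ _ → + 0) ]) r p + x * (M [ p ← w ]) r p
  at r = trans (set-at M p xw r) (trans (sym (+-identityˡ (xw r)))
    (sym (cong₂ (λ a b → a + x * b) (set-at M p (λ _ → + 0) r) (set-at M p w r))))

-- As vᵢ = 0, replacing the i-th column of M does not change M v.
kernel-vanishing : ∀ {n} (M : Matrix n) i w → det n (M [ i ← w ]) ≢ + 0 →
                   ∀ v → (∀ r → (M ∙ v) r ≡ + 0) → v i ≡ + 0 → ∀ l → v l ≡ + 0
kernel-vanishing {n} M i w d≢0 v Mv≡0 vᵢ≡0 l with i*j≡0⇒i≡0∨j≡0 (det n N) product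
  where
  N : Matrix n
  N = M [ i ← w ]
  Nv≡0 : ∀ r → (N ∙ v) r ≡ + 0
  Nv≡0 r = trans (Σ-cong n same) (Mv≡0 r)
    where
    same : ∀ j → N r j * v j ≡ M r j * v j
    same j with j ≟ i
    ... | yes refl = trans (cong (w r *_) vᵢ≡0) (trans (*-zeroʳ (w r)) (sym (trans (cong (M r j *_) vᵢ≡0) (*-zeroʳ (M r j)))))
    ... | no _     = refl
  product : det n N * v l ≡ + 0
  product = trans (sym (cramer n N v l)) (det-zero-column n (N [ l ← N ∙ v ]) l (λ r → trans (set-at N l (N ∙ v) r) (Nv≡0 r)))
... | inj₁ d≡0 = contradiction d≡0 d≢0
... | inj₂ vₗ≡0 = vₗ≡0

-- Symmetric matrices and polynomials in them

infix 4 _≗0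

_≗0 : ∀ {n} → Vector n → Set
v ≗0 = ∀ i → v i ≡ + 0

private
  plus-one : ∀ a b → a + b ≡ a + + 1 * b
  plus-one = solve-∀
  zero-plus : ∀ c b → c * b ≡ + 0 + c * b
  zero-plus = solve-∀

Σ-+ : ∀ n (f g : Vector n) → Σℤ n (λ i → f i + g i) ≡ Σℤ n f + Σℤ n g
Σ-+ n f g = trans (Σ-cong n (λ i → plus-one (f i) (g i)))
  (trans (Σ-linear n (+ 1) f g) (sym (plus-one (Σℤ n f) (Σℤ n g))))

Σ-*ˡ : ∀ n c (f : Vector n) → Σℤ n (λ i → c * f i) ≡ c * Σℤ n f
Σ-*ˡ zero    c f = sym (*-zeroʳ c)
Σ-*ˡ (suc n) c f = trans (cong (λ t → c * f zero + t) (Σ-*ˡ n c (f ∘ suc))) (sym (*-distribˡ-+ c (f zero) (Σℤ n (f ∘ suc))))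

Σ-*ʳ : ∀ n (f : Vector n) c → Σℤ n (λ i → f i * c) ≡ Σℤ n f * c
Σ-*ʳ n f c = trans (Σ-cong n (λ i → *-comm (f i) c)) (trans (Σ-*ˡ n c f) (*-comm c (Σℤ n f)))

Σ-swap : ∀ m n (f : Fin m → Fin n → ℤ) → Σℤ m (λ i → Σℤ n (f i)) ≡ Σℤ n (λ j → Σℤ m (λ i → f i j))
Σ-swap zero    n f = sym (Σ-zero n (λ _ → refl))
Σ-swap (suc m) n f = trans (cong (λ t → Σℤ n (f zero) + t) (Σ-swap m n (f ∘ suc)))
  (sym (Σ-+ n (f zero) (λ j → Σℤ m (λ i → f (suc i) j))))

Σ-mono : ∀ n {f g : Vector n} → (∀ i → f i ≤ g i) → Σℤ n f ≤ Σℤ n g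
Σ-mono zero    h = ≤-refl
Σ-mono (suc n) h = +-mono-≤ (h zero) (Σ-mono n (h ∘ suc))

Σ-nonneg : ∀ n {f : Vector n} → (∀ i → + 0 ≤ f i) → + 0 ≤ Σℤ n f
Σ-nonneg n {f} h = subst (_≤ Σℤ n f) (Σ-zero n (λ _ → refl)) (Σ-mono n h)

Σ-const : ∀ n c → Σℤ n (λ _ → c) ≡ + n * c
Σ-const zero    c = refl
Σ-const (suc n) c = trans (cong (λ t → c + t) (Σ-const n c)) (sym ([1+m]*n≡n+m*n n c))
  where
  [1+m]*n≡n+m*n : ∀ m c → + suc m * c ≡ c + + m * c
  [1+m]*n≡n+m*n m c = trans (cong (_* c) (pos-+ 1 m)) (shape (+ m) c)
    where
    shape : ∀ m c → (+ 1 + m) * c ≡ c + m * c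
    shape = solve-∀

nonneg-sum-zero : ∀ {a b} → + 0 ≤ a → + 0 ≤ b → a + b ≡ + 0 → a ≡ + 0 × b ≡ + 0
nonneg-sum-zero {+ m} {+ n} _ _ eq with ℕ.m+n≡0⇒m≡0 m (+-injective eq) | ℕ.m+n≡0⇒n≡0 m (+-injective eq)
... | refl | refl = refl , refl

Σ-nonneg-zero : ∀ n {f : Vector n} → (∀ i → + 0 ≤ f i) → Σℤ n f ≡ + 0 → f ≗0
Σ-nonneg-zero (suc n) h eq zero    = proj₁ (nonneg-sum-zero (h zero) (Σ-nonneg n (h ∘ suc)) eq)
Σ-nonneg-zero (suc n) h eq (suc i) =
  Σ-nonneg-zero n (h ∘ suc) (proj₂ (nonneg-sum-zero (h zero) (Σ-nonneg n (h ∘ suc)) eq)) i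

infix 9 _·_

_·_ : ∀ {n} → Vector n → Vector n → ℤ
_·_ {n} u v = Σℤ n (λ i → u i * v i)

square-nonneg : ∀ x → + 0 ≤ x * x
square-nonneg (+ n)    = subst (+ 0 ≤_) (pos-* n n) (+≤+ ℕ.z≤n)
square-nonneg -[1+ n ] = +≤+ ℕ.z≤n

·-definite : ∀ {n} (v : Vector n) → v · v ≡ + 0 → v ≗0
·-definite {n} v eq i = reduce (i*j≡0⇒i≡0∨j≡0 (v i) (Σ-nonneg-zero n (λ i → square-nonneg (v i)) eq i))

-- The operators S - θ and their products

module _ {n} (S : Matrix n) where

  ∙-cong : ∀ {u v} → u ≗ v → S ∙ u ≗ S ∙ v
  ∙-cong h i = Σ-cong n (λ j → cong (S i j *_) (h j))

  ∙-linear : ∀ c u v i → (S ∙ (λ i → u i + c * v i)) i ≡ (S ∙ u) i + c * (S ∙ v) i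
  ∙-linear c u v i = trans (Σ-cong n (λ j → shape (S i j) (u j) c (v j)))
    (Σ-linear n c (λ j → S i j * u j) (λ j → S i j * v j))
    where
    shape : ∀ s u c v → s * (u + c * v) ≡ s * u + c * (s * v)
    shape = solve-∀

  T : ℤ → Vector n → Vector n
  T θ v i = (S ∙ v) i - θ * v i

  T-cong : ∀ θ {u v} → u ≗ v → T θ u ≗ T θ v
  T-cong θ h i = cong₂ (λ a b → a - θ * b) (∙-cong h i) (h i)

  T-zero : ∀ θ {v} → v ≗0 → T θ v ≗0
  T-zero θ {v} h i = trans (cong₂ (λ a b → a - θ * b) (Σ-zero n (λ j → trans (cong (S i j *_) (h j)) (*-zeroʳ (S i j)))) (h i)) (shape θ)
    where
    shape : ∀ θ → + 0 - θ * + 0 ≡ + 0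
    shape = solve-∀

  T-linear : ∀ θ c u v i → T θ (λ i → u i + c * v i) i ≡ T θ u i + c * T θ v i
  T-linear θ c u v i = trans (cong (_- θ * (u i + c * v i)) (∙-linear c u v i)) (shape θ c (u i) (v i) ((S ∙ u) i) ((S ∙ v) i))
    where
    shape : ∀ θ c u v su sv → su + c * sv - θ * (u + c * v) ≡ (su - θ * u) + c * (sv - θ * v)
    shape = solve-∀

  T-scale : ∀ θ c v i → T θ (λ i → c * v i) i ≡ c * T θ v i
  T-scale θ c v i = trans (T-cong θ (λ i → zero-plus c (v i)) i)
    (trans (T-linear θ c (λ _ → + 0) v i) (trans (cong (_+ c * T θ v i) (T-zero θ (λ _ → refl) i)) (+-identityˡ _)))

  pow : ℤ → ℕ → Vector n → Vector n
  pow θ zero    v = v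
  pow θ (suc m) v = T θ (pow θ m v)

  T-T : ∀ θ φ v i → T θ (T φ v) i ≡ ((S ∙ (S ∙ v)) i - φ * (S ∙ v) i) - θ * ((S ∙ v) i - φ * v i)
  T-T θ φ v i = cong (_- θ * T φ v i) (trans (∙-cong (λ j → minus ((S ∙ v) j) φ (v j)) i)
    (trans (∙-linear (- φ) (S ∙ v) v i) (sym (minus ((S ∙ (S ∙ v)) i) φ ((S ∙ v) i)))))
    where
    minus : ∀ a φ b → a - φ * b ≡ a + - φ * b
    minus = solve-∀

  T-comm : ∀ θ φ v → T θ (T φ v) ≗ T φ (T θ v)
  T-comm θ φ v i = trans (T-T θ φ v i) (trans (shape θ φ (v i) ((S ∙ v) i) ((S ∙ (S ∙ v)) i)) (sym (T-T φ θ v i)))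
    where
    shape : ∀ θ φ v sv ssv → (ssv - φ * sv) - θ * (sv - φ * v) ≡ (ssv - θ * sv) - φ * (sv - θ * v)
    shape = solve-∀

  T-pow-comm : ∀ θ φ m v → T θ (pow φ m v) ≗ pow φ m (T θ v)
  T-pow-comm θ φ zero    v i = refl
  T-pow-comm θ φ (suc m) v i = trans (T-comm θ φ (pow φ m v) i) (T-cong φ (T-pow-comm θ φ m v) i)

  pow-cong : ∀ θ m {u v} → u ≗ v → pow θ m u ≗ pow θ m v
  pow-cong θ zero    h = h
  pow-cong θ (suc m) h = T-cong θ (pow-cong θ m h)

  -- p is the polynomial function of F: p(x) v ≡ F v modulo the image of S - x.
  record Represents (p : ℤ → ℤ) (F : Vector n → Vector n) : Set where
    constructor represents
    field reduceAt : ∀ x v → ∃ λ w → ∀ i → p x * v i ≡ F v i - T x w i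
  open Represents public

  represents-id : Represents (λ _ → + 1) id
  represents-id = represents λ x v → (λ _ → + 0) , λ i → trans (shape (v i)) (cong (λ t → v i - t) (sym (T-zero x (λ _ → refl) i)))
    where
    shape : ∀ v → + 1 * v ≡ v - + 0
    shape = solve-∀

  represents-T : ∀ θ → Represents (λ x → x - θ) (T θ)
  represents-T θ = represents λ x v → v , λ i → shape x θ (v i) ((S ∙ v) i)
    where
    shape : ∀ x θ v sv → (x - θ) * v ≡ (sv - θ * v) - (sv - x * v)
    shape = solve-∀

  -- Modulo the image of S - x, p(x) q(x) v is congruent to p(x) G v, and this to F (G v); the error
  -- of the first congruence gets multiplied by the number p(x).
  represents-∘ : ∀ {p q F G} → Represents p F → Represents q G → Represents (λ x → p x * q x) (F ∘ G)
  represents-∘ {p} {q} {F} {G} P Q = represents λ x v →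
    let w , Qw = reduceAt Q x v
        u , Pu = reduceAt P x (G v)
    in (λ i → u i + p x * w i) , λ i → trans (shape₁ (p x) (q x) (v i))
      (trans (cong (p x *_) (Qw i)) (trans (shape₂ (p x) (G v i) (T x w i))
        (trans (cong (_- p x * T x w i) (Pu i)) (trans (shape₃ (F (G v) i) (T x u i) (p x * T x w i))
          (cong (λ t → F (G v) i - t) (sym (T-linear x (p x) u w i)))))))
    where
    shape₁ : ∀ p q v → p * q * v ≡ p * (q * v)
    shape₁ = solve-∀
    shape₂ : ∀ p g t → p * (g - t) ≡ p * g - p * t
    shape₂ = solve-∀
    shape₃ : ∀ f a b → f - a - b ≡ f - (a + b)
    shape₃ = solve-∀

  represents-pow : ∀ θ m → Represents (λ x → (x - θ) ^ m) (pow θ m)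
  represents-pow θ zero    = represents-id
  represents-pow θ (suc m) = represents-∘ (represents-T θ) (represents-pow θ m)

  module _ (S-sym : ∀ i j → S i j ≡ S j i) where

    T-self-adjoint : ∀ θ u v → T θ u · v ≡ u · T θ v
    T-self-adjoint θ u v = begin
      Σℤ n (λ i → T θ u i * v i)
        ≡⟨ Σ-cong n (λ i → left ((S ∙ u) i) θ (u i) (v i)) ⟩
      Σℤ n (λ i → (S ∙ u) i * v i + - θ * (u i * v i))
        ≡⟨ Σ-linear n (- θ) (λ i → (S ∙ u) i * v i) (λ i → u i * v i) ⟩
      (S ∙ u) · v + - θ * (u · v)
        ≡⟨ cong (_+ - θ * (u · v)) S-self-adjoint ⟩
      u · (S ∙ v) + - θ * (u · v)
        ≡⟨ Σ-linear n (- θ) (λ i → u i * (S ∙ v) i) (λ i → u i * v i) ⟨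
      Σℤ n (λ i → u i * (S ∙ v) i + - θ * (u i * v i))
        ≡⟨ Σ-cong n (λ i → right ((S ∙ v) i) θ (u i) (v i)) ⟨
      u · T θ v ∎
      where
      open ≡-Reasoning
      left : ∀ s θ u v → (s - θ * u) * v ≡ s * v + - θ * (u * v)
      left = solve-∀
      right : ∀ s θ u v → u * (s - θ * v) ≡ u * s + - θ * (u * v)
      right = solve-∀
      rotate : ∀ s u v → s * u * v ≡ u * (s * v)
      rotate = solve-∀
      S-self-adjoint : (S ∙ u) · v ≡ u · (S ∙ v)
      S-self-adjoint = begin
        Σℤ n (λ i → (S ∙ u) i * v i)                     ≡⟨ Σ-cong n (λ i → Σ-*ʳ n (λ j → S i j * u j) (v i)) ⟨
        Σℤ n (λ i → Σℤ n (λ j → S i j * u j * v i))      ≡⟨ Σ-swap n n (λ i j → S i j * u j * v i) ⟩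
        Σℤ n (λ j → Σℤ n (λ i → S i j * u j * v i))
          ≡⟨ Σ-cong n (λ j → Σ-cong n (λ i → trans (rotate (S i j) (u j) (v i)) (cong (λ s → u j * (s * v i)) (S-sym i j)))) ⟩
        Σℤ n (λ j → Σℤ n (λ i → u j * (S j i * v i)))    ≡⟨ Σ-cong n (λ j → Σ-*ˡ n (u j) (λ i → S j i * v i)) ⟩
        u · (S ∙ v)                                      ∎

    -- By self-adjointness the squared length of `T θ v` is the inner product of `v` with
    -- `T θ (T θ v)`.
    T-reduced : ∀ θ v → T θ (T θ v) ≗0 → T θ v ≗0
    T-reduced θ v h = ·-definite (T θ v) (trans (T-self-adjoint θ v (T θ v))
      (Σ-zero n (λ i → trans (cong (v i *_) (h i)) (*-zeroʳ (v i)))))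

    -- A symmetric matrix has no nontrivial Jordan blocks; this strips the multiplicities from the
    -- characteristic polynomial.
    pow-reduced : ∀ θ m v → pow θ m v ≗0 → T θ v ≗0
    pow-reduced θ zero          v h = T-zero θ h
    pow-reduced θ (suc zero)    v h = h
    pow-reduced θ (suc (suc m)) v h = pow-reduced θ (suc m) v (T-reduced θ (pow θ m v) h)

-- The l1-norm, and divisibility by S - x for all x

norm : ∀ {n} → Vector n → ℤ
norm {n} u = Σℤ n (λ i → + ∣ u i ∣)

norm-nonneg : ∀ {n} (u : Vector n) → + 0 ≤ norm u
norm-nonneg {n} u = Σ-nonneg n (λ _ → +≤+ ℕ.z≤n)

∣Σ∣≤Σ∣∣ : ∀ n (f : Vector n) → + ∣ Σℤ n f ∣ ≤ Σℤ n (λ i → + ∣ f i ∣)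
∣Σ∣≤Σ∣∣ zero    f = ≤-refl
∣Σ∣≤Σ∣∣ (suc n) f = ≤-trans (+≤+ (∣i+j∣≤∣i∣+∣j∣ (f zero) (Σℤ n (f ∘ suc))))
  (+-monoʳ-≤ (+ ∣ f zero ∣) (∣Σ∣≤Σ∣∣ n (f ∘ suc)))

module _ {n} (S : Matrix n) (k : ℤ) (S≥0 : ∀ i j → + ∣ S i j ∣ ≡ S i j) (columns : ∀ j → Σℤ n (λ i → S i j) ≡ k) where

  -- For the l1-norm, the operator norm of a nonnegative matrix is its largest column sum.
  norm-∙ : ∀ u → norm (S ∙ u) ≤ k * norm u
  norm-∙ u = begin
    Σℤ n (λ i → + ∣ Σℤ n (λ j → S i j * u j) ∣)     ≤⟨ Σ-mono n (λ i → ∣Σ∣≤Σ∣∣ n (λ j → S i j * u j)) ⟩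
    Σℤ n (λ i → Σℤ n (λ j → + ∣ S i j * u j ∣))     ≡⟨ Σ-cong n (λ i → Σ-cong n (λ j → abs i j)) ⟩
    Σℤ n (λ i → Σℤ n (λ j → S i j * + ∣ u j ∣))     ≡⟨ Σ-swap n n (λ i j → S i j * + ∣ u j ∣) ⟩
    Σℤ n (λ j → Σℤ n (λ i → S i j * + ∣ u j ∣))     ≡⟨ Σ-cong n (λ j → trans (Σ-*ʳ n (λ i → S i j) (+ ∣ u j ∣)) (cong (_* + ∣ u j ∣) (columns j))) ⟩
    Σℤ n (λ j → k * + ∣ u j ∣)                      ≡⟨ Σ-*ˡ n k (λ j → + ∣ u j ∣) ⟩
    k * norm u                                      ∎
    where
    open ≤-Reasoning
    abs : ∀ i j → + ∣ S i j * u j ∣ ≡ S i j * + ∣ u j ∣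
    abs i j = trans (cong +_ (abs-* (S i j) (u j))) (trans (pos-* ∣ S i j ∣ ∣ u j ∣) (cong (_* + ∣ u j ∣) (S≥0 i j)))

  -- For x > k + ‖Z‖ the integer vector u has norm less than 1, hence is zero.
  divisible-by-all : ∀ Z → (∀ x → ∃ λ u → T S x u ≗ Z) → Z ≗0
  divisible-by-all Z solve with solve (k + (+ 1 + norm Z))
  ... | u , Tu≗Z = λ i → trans (sym (Tu≗Z i)) (T-zero S x u≗0 i)
    where
    x : ℤ
    x = k + (+ 1 + norm Z)
    scaled : ∀ i → x * u i ≡ (S ∙ u) i - Z i
    scaled i = trans (shape x (u i) ((S ∙ u) i)) (cong (λ t → (S ∙ u) i - t) (Tu≗Z i))
      where
      shape : ∀ x u s → x * u ≡ s - (s - x * u)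
      shape = solve-∀
    upper : x * norm u ≤ k * norm u + norm Z
    upper = begin
      x * norm u                                   ≡⟨ Σ-*ˡ n x (λ i → + ∣ u i ∣) ⟨
      Σℤ n (λ i → x * + ∣ u i ∣)                   ≤⟨ Σ-mono n (λ i → pointwise i) ⟩
      Σℤ n (λ i → + ∣ (S ∙ u) i ∣ + + ∣ Z i ∣)     ≡⟨ Σ-+ n (λ i → + ∣ (S ∙ u) i ∣) (λ i → + ∣ Z i ∣) ⟩
      norm (S ∙ u) + norm Z                        ≤⟨ +-monoˡ-≤ (norm Z) (norm-∙ u) ⟩
      k * norm u + norm Z                          ∎
      where
      open ≤-Reasoning
      x*∣∣ : ∀ i → x * + ∣ u i ∣ ≤ + ∣ x * u i ∣
      x*∣∣ i = ≤-trans (*-monoʳ-≤-nonNeg (+ ∣ u i ∣) (i≤∣i∣ x)) (≤-reflexive (trans (sym (pos-* ∣ x ∣ ∣ u i ∣)) (cong +_ (sym (abs-* x (u i))))))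
        where
        i≤∣i∣ : ∀ i → i ≤ + ∣ i ∣
        i≤∣i∣ (+ _)    = ≤-refl
        i≤∣i∣ -[1+ _ ] = -≤+
      pointwise : ∀ i → x * + ∣ u i ∣ ≤ + ∣ (S ∙ u) i ∣ + + ∣ Z i ∣
      pointwise i = ≤-trans (x*∣∣ i) (subst (λ t → + ∣ t ∣ ≤ + ∣ (S ∙ u) i ∣ + + ∣ Z i ∣) (sym (scaled i)) (+≤+ (∣i-j∣≤∣i∣+∣j∣ ((S ∙ u) i) (Z i))))
    small : (+ 1 + norm Z) * norm u ≤ norm Z
    small = 0≤i-j⇒j≤i (subst (+ 0 ≤_) (shape k (norm u) (norm Z)) (i≤j⇒0≤j-i upper))
      where
      shape : ∀ k u z → k * u + z - (k + (+ 1 + z)) * u ≡ z - (+ 1 + z) * u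
      shape = solve-∀
    -- Integrality enters here: a positive `w` is at least 1 and would make the left side exceed
    -- `z`.
    at-most : ∀ {z w} → + 0 ≤ z → + 0 ≤ w → (+ 1 + z) * w ≤ z → w ≡ + 0
    at-most {+ z} {+ zero}  _ _ _ = refl
    at-most {+ z} {+ suc w} _ _ h = contradiction (ℕ.≤-trans (ℕ.m≤m*n (suc z) (suc w)) (drop‿+≤+ (subst (_≤ + z) (sym (pos-* (suc z) (suc w))) h))) (ℕ.<-irrefl refl)
    u≗0 : u ≗0
    u≗0 i = ∣i∣≡0⇒i≡0 (+-injective (Σ-nonneg-zero n (λ _ → +≤+ ℕ.z≤n) (at-most (norm-nonneg Z) (norm-nonneg u) small) i))

-- Integer arithmetic

-- One factor is at least 1 and the other at most -1, so one of α, β is at least 0 and the other at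
-- most -2.
product-nonpositive : ∀ α β → (+ 1 + α) * (+ 1 + β) < + 0 → α * β ≤ + 0
product-nonpositive (+ m)    (+ n)    h = contradiction h (≤⇒≯ (subst (+ 0 ≤_) (pos-* (suc m) (suc n)) (+≤+ ℕ.z≤n)))
product-nonpositive (+ zero) -[1+ n ] _ = ≤-refl
product-nonpositive (+ suc m) -[1+ n ] _ = -≤+
product-nonpositive -[1+ m ] (+ zero) _ = ≤-reflexive (*-zeroʳ -[1+ m ])
product-nonpositive -[1+ m ] (+ suc n) _ = -≤+
product-nonpositive -[1+ zero ] -[1+ n ] (+<+ ())
product-nonpositive -[1+ suc m ] -[1+ zero ] h = contradiction h (<-irrefl (*-zeroʳ -[1+ m ]))
product-nonpositive -[1+ suc m ] -[1+ suc n ] (+<+ ())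

private
  negate-bound : ∀ {x} → x ≤ + 0 → x ≢ + 0 → + 1 ≤ - x
  negate-bound {+ zero}     _ x≢0 = contradiction refl x≢0
  negate-bound { -[1+ n ]}  _ _   = +≤+ (ℕ.s≤s ℕ.z≤n)
  negate-bound {+ suc n} (+≤+ ()) _

  quotient-one : ∀ {n u} → + 1 ≤ + n * u → + n * u < + n * + 2 → u ≡ + 1
  quotient-one {n} {+ zero} h _ = contradiction (subst (+ 1 ≤_) (*-zeroʳ (+ n)) h) λ { (+≤+ ()) }
  quotient-one {n} {+ suc zero} _ _ = refl
  quotient-one {n} {+ suc (suc u)} _ h = contradiction (*-cancelˡ-<-nonNeg (+ n) h) λ { (+<+ (ℕ.s≤s (ℕ.s≤s ()))) }
  quotient-one {zero} { -[1+ u ]} (+≤+ ()) _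
  quotient-one {suc n} { -[1+ u ]} () _

product-positive : ∀ {x y} → + 0 < x → + 0 < y → + 0 < x * y
product-positive {+ suc x} {+ suc y} _ _ = +<+ (ℕ.s≤s ℕ.z≤n)
product-positive {+ zero} (+<+ ()) _
product-positive {+ suc x} {+ zero} _ (+<+ ())

-- In the application `s` counts the common neighbours of two adjacent vertices. Its bounds give 1 ≤
-- N ≤ k - 1 < n for N = -ab, so 2N lies strictly between 0 and 2n, and divisibility by n leaves
-- only n = 2N.
no-parameters : ∀ n k α β s t →
  + n * (+ k + α * β) ≡ (+ k - α) * (+ k - β) + (+ 1 + α) * (+ 1 + β) →
  (+ 1 + α) * (+ 1 + β) ≢ + 0 →
  + k + + 1 ≤ + n →
  s ≡ + k - + 1 + (+ 1 + α) * (+ 1 + β) → + 0 ≤ s → s ≤ + k - + 1 →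
  ¬ + 2 * ((+ 1 + α) * (+ 1 + β)) ≡ + n * t
no-parameters n k α β s t E ab≢0 k<n s≡ 0≤s s≤ 2ab≡nt = contradiction (<-≤-trans lhs>0 (≤-trans (≤-reflexive key) rhs≤0)) (<-irrefl refl)
  where
  K = + k
  ab = (+ 1 + α) * (+ 1 + β)
  N = - ab
  ab≤0 : ab ≤ + 0
  ab≤0 = 0≤i-j⇒j≤i (subst (+ 0 ≤_) (trans (cong (λ s → K - + 1 - s) s≡) (shape K ab)) (i≤j⇒0≤j-i s≤))
    where
    shape : ∀ K x → K - + 1 - (K - + 1 + x) ≡ + 0 - x
    shape = solve-∀
  N≥1 : + 1 ≤ N
  N≥1 = negate-bound ab≤0 ab≢0
  K-N≥1 : + 1 ≤ K - N
  K-N≥1 = 0≤i-j⇒j≤i (subst (+ 0 ≤_) (trans s≡ (shape K ab)) 0≤s)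
    where
    shape : ∀ K x → K - + 1 + x ≡ K - - x - + 1
    shape = solve-∀
  n*-t : + n * - t ≡ + 2 * N
  n*-t = trans (sym (neg-distribʳ-* (+ n) t)) (trans (cong -_ (sym 2ab≡nt)) (neg-distribʳ-* (+ 2) ab))
  N<n : N < + n
  N<n = <-≤-trans (≤-<-trans (0≤i-j⇒j≤i (≤-trans (+≤+ ℕ.z≤n) K-N≥1)) (subst (K <_) (+-comm (+ 1) K) (suc[i]≤j⇒i<j ≤-refl))) k<n
  n≡2N : + n ≡ + 2 * N
  n≡2N = trans (sym (*-identityʳ (+ n))) (trans (cong (+ n *_) (sym u≡1)) n*-t)
    where
    u≡1 : - t ≡ + 1
    u≡1 = quotient-one {n} (subst (+ 1 ≤_) (sym n*-t) (≤-trans (+≤+ (ℕ.s≤s ℕ.z≤n)) (*-monoˡ-≤-nonNeg (+ 2) N≥1)))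
      (subst₂ _<_ (sym n*-t) (*-comm (+ 2) (+ n)) (*-monoˡ-<-pos (+ 2) N<n))
  q = α * β
  q≤0 : q ≤ + 0
  q≤0 = product-nonpositive α β (≤∧≢⇒< ab≤0 ab≢0)
  -- Eliminate α + β from `E` through ab = 1 + α + β + αβ; what remains is a multiple of n - 2N.
  key : (K + + 1) * (K - N) ≡ q * (+ n - (K + + 1))
  key = i-j≡0⇒i≡j _ _ (trans (shape K α β (+ n))
    (trans (cong₂ (λ x y → x + K * y) (i≡j⇒i-j≡0 (sym E)) (i≡j⇒i-j≡0 n≡2N)) (vanish K)))
    where
    shape : ∀ K α β n → (K + + 1) * (K - - ((+ 1 + α) * (+ 1 + β))) - α * β * (n - (K + + 1))
      ≡ ((K - α) * (K - β) + (+ 1 + α) * (+ 1 + β) - n * (K + α * β)) + K * (n - + 2 * - ((+ 1 + α) * (+ 1 + β)))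
    shape = solve-∀
    vanish : ∀ K → + 0 + K * + 0 ≡ + 0
    vanish = solve-∀
  lhs>0 : + 0 < (K + + 1) * (K - N)
  lhs>0 = product-positive (subst (+ 0 <_) (+-comm (+ 1) K) (+<+ (ℕ.s≤s ℕ.z≤n))) (<-≤-trans (+<+ (ℕ.s≤s ℕ.z≤n)) K-N≥1)
  rhs≤0 : q * (+ n - (K + + 1)) ≤ + 0
  rhs≤0 = *-monoʳ-≤-nonNeg (+ n - (K + + 1)) {{nonNegative (i≤j⇒0≤j-i k<n)}} q≤0

product-minus-one : ∀ α β → α * β ≡ - + 1 → α ≡ - + 1 ⊎ β ≡ - + 1
product-minus-one α β eq = units α β (ℕ.m*n≡1⇒m≡1 ∣ α ∣ ∣ β ∣ abs) (ℕ.m*n≡1⇒n≡1 ∣ α ∣ ∣ β ∣ abs) eq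
  where
  abs : ∣ α ∣ ℕ.* ∣ β ∣ ≡ 1
  abs = trans (sym (abs-* α β)) (cong ∣_∣ eq)
  units : ∀ α β → ∣ α ∣ ≡ 1 → ∣ β ∣ ≡ 1 → α * β ≡ - + 1 → α ≡ - + 1 ⊎ β ≡ - + 1
  units -[1+ .0 ] β refl _ _ = inj₁ refl
  units (+ 1) -[1+ .0 ] _ refl _ = inj₂ refl
  units (+ 1) (+ 1) _ _ ()

-- For k = 1 the equation becomes (n - 2)(1 + αβ) = 0, and αβ = -1 makes α or β equal to -1. The
-- case is excluded because the only neighbour would carry the sign minus in the row of D.
degree-not-one : ∀ n k α β → 3 ℕ.≤ n → - + 1 ≢ α → - + 1 ≢ β →
  + n * (+ k + α * β) ≡ (+ k - α) * (+ k - β) + (+ 1 + α) * (+ 1 + β) → + k ≢ + 1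
degree-not-one n k α β 3≤n α≢ β≢ E k≡1 with i*j≡0⇒i≡0∨j≡0 (+ n - + 2) factored
  where
  factored : (+ n - + 2) * (+ 1 + α * β) ≡ + 0
  factored = trans (shape (+ n) α β) (i≡j⇒i-j≡0 (subst (λ k → + n * (k + α * β) ≡ (k - α) * (k - β) + (+ 1 + α) * (+ 1 + β)) k≡1 E))
    where
    shape : ∀ n α β → (n - + 2) * (+ 1 + α * β) ≡ n * (+ 1 + α * β) - ((+ 1 - α) * (+ 1 - β) + (+ 1 + α) * (+ 1 + β))
    shape = solve-∀
... | inj₁ n≡2 with i-j≡0⇒i≡j (+ n) (+ 2) n≡2
...   | refl = contradiction 3≤n λ { (ℕ.s≤s (ℕ.s≤s ())) }
degree-not-one n k α β 3≤n α≢ β≢ E k≡1 | inj₂ 1+αβ≡0 with product-minus-one α β (trans (shape (α * β)) (cong (_- + 1) 1+αβ≡0))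
  where
  shape : ∀ x → x ≡ + 1 + x - + 1
  shape = solve-∀
... | inj₁ eq = contradiction (sym eq) α≢
... | inj₂ eq = contradiction (sym eq) β≢

pow-nonzero : ∀ x m → x ≢ + 0 → x ^ m ≢ + 0
pow-nonzero x zero    _   ()
pow-nonzero x (suc m) x≢0 eq with i*j≡0⇒i≡0∨j≡0 x eq
... | inj₁ x≡0 = x≢0 x≡0
... | inj₂ p≡0 = pow-nonzero x m x≢0 p≡0

product-nonzero : ∀ {x y} → x ≢ + 0 → y ≢ + 0 → x * y ≢ + 0
product-nonzero {x} x≢0 y≢0 eq with i*j≡0⇒i≡0∨j≡0 x eq
... | inj₁ x≡0 = x≢0 x≡0
... | inj₂ y≡0 = y≢0 y≡0

*-cancelˡ-zero : ∀ x y → x ≢ + 0 → x * y ≡ + 0 → y ≡ + 0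
*-cancelˡ-zero x y x≢0 eq with i*j≡0⇒i≡0∨j≡0 x eq
... | inj₁ x≡0 = contradiction x≡0 x≢0
... | inj₂ y≡0 = y≡0

equal-squares : ∀ x y → x * x ≡ y * y → x ≡ y ⊎ x ≡ - y
equal-squares x y eq with i*j≡0⇒i≡0∨j≡0 (x - y) (trans (shape x y) (i≡j⇒i-j≡0 eq))
  where
  shape : ∀ x y → (x - y) * (x + y) ≡ x * x - y * y
  shape = solve-∀
... | inj₁ x-y≡0 = inj₁ (i-j≡0⇒i≡j x y x-y≡0)
... | inj₂ x+y≡0 = inj₂ (trans (shape x y) (trans (cong (_- y) x+y≡0) (+-identityˡ (- y))))
  where
  shape : ∀ x y → x ≡ x + y - y
  shape = solve-∀

-- Adjacency matrices of regular graphs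

-- With this order of indices `e i` is definitionally the column `λ r → δ r i` of the determinant
-- lemmas.
e : ∀ {n} → Fin n → Vector n
e i j = δ j i

e-· : ∀ {n} i (v : Vector n) → e i · v ≡ v i
e-· {n} i v = trans (Σ-cong n (λ j → trans (*-comm (δ j i) (v j)) (cong (v j *_) (δ-sym j i)))) (Σ-δ v i)

·-e : ∀ {n} i (v : Vector n) → v · e i ≡ v i
·-e {n} i v = trans (Σ-cong n (λ j → *-comm (v j) (δ j i))) (e-· i v)

module _ {n} (G : Graph n) where

  A-sym : ∀ i j → A G i j ≡ A G j i
  A-sym i j = cong (λ b → if b then + 1 else + 0) (symmetric G i j)

  A-loopless : ∀ i → A G i i ≡ + 0
  A-loopless i = cong (λ b → if b then + 1 else + 0) (loopless G i)

  A-abs : ∀ i j → + ∣ A G i j ∣ ≡ A G i j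
  A-abs i j with adj G i j
  ... | true  = refl
  ... | false = refl

  A-nonneg : ∀ i j → + 0 ≤ A G i j
  A-nonneg i j = subst (+ 0 ≤_) (A-abs i j) (+≤+ ℕ.z≤n)

  A-idempotent : ∀ i j → A G i j * A G i j ≡ A G i j
  A-idempotent i j with adj G i j
  ... | true  = refl
  ... | false = refl

  A-nonzero : ∀ i j → A G i j ≢ + 0 → A G i j ≡ + 1
  A-nonzero i j ≢0 with adj G i j
  ... | true  = refl
  ... | false = contradiction refl ≢0

  -- Repeats the expression in `charPoly`, so that its determinant is `charPoly G x` by definition.
  xI-A : ℤ → Matrix n
  xI-A x i j = (if does (i ≟ j) then x else + 0) - A G i j

  xI-A-entry : ∀ x i j → xI-A x i j ≡ x * δ i j - A G i j
  xI-A-entry x i j with does (i ≟ j)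
  ... | true  = cong (_- A G i j) (sym (*-identityʳ x))
  ... | false = cong (_- A G i j) (sym (*-zeroʳ x))

  xI-A-sym : ∀ x i j → xI-A x i j ≡ xI-A x j i
  xI-A-sym x i j = trans (xI-A-entry x i j) (trans (cong₂ (λ a b → x * a - b) (δ-sym i j) (A-sym i j)) (sym (xI-A-entry x j i)))

  xI-A-∙ : ∀ x v i → (xI-A x ∙ v) i ≡ - T (A G) x v i
  xI-A-∙ x v i = begin
    Σℤ n (λ j → xI-A x i j * v j)
      ≡⟨ Σ-cong n (λ j → trans (cong (_* v j) (xI-A-entry x i j)) (shape x (δ i j) (A G i j) (v j))) ⟩
    Σℤ n (λ j → x * v j * δ i j + - + 1 * (A G i j * v j))
      ≡⟨ Σ-linear n (- + 1) (λ j → x * v j * δ i j) (λ j → A G i j * v j) ⟩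
    Σℤ n (λ j → x * v j * δ i j) + - + 1 * (A G ∙ v) i
      ≡⟨ cong (_+ - + 1 * (A G ∙ v) i) (Σ-δ (λ j → x * v j) i) ⟩
    x * v i + - + 1 * (A G ∙ v) i
      ≡⟨ shape₂ (x * v i) ((A G ∙ v) i) ⟩
    - T (A G) x v i ∎
    where
    open ≡-Reasoning
    shape : ∀ x d a v → (x * d - a) * v ≡ x * v * d + - + 1 * (a * v)
    shape = solve-∀
    shape₂ : ∀ a b → a + - + 1 * b ≡ - (b - a)
    shape₂ = solve-∀

  xI-A-shift : ∀ x h i j → xI-A x i j + h * δ i j ≡ xI-A (x + h) i j
  xI-A-shift x h i j = trans (cong (_+ h * δ i j) (xI-A-entry x i j))
    (trans (shape x h (δ i j) (A G i j)) (sym (xI-A-entry (x + h) i j)))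
    where
    shape : ∀ x h d a → x * d - a + h * d ≡ (x + h) * d - a
    shape = solve-∀

  -- Row `i` of the adjugate of xI - A.
  minor-vector : ℤ → Fin n → Vector n
  minor-vector x i j = det n (xI-A x [ i ← e j ])

  T-minor-vector : ∀ x i l → T (A G) x (minor-vector x i) l ≡ - (charPoly G x * e i l)
  T-minor-vector x i l = trans (sym (neg-involutive _)) (cong -_ (begin
    - T (A G) x (minor-vector x i) l
      ≡⟨ xI-A-∙ x (minor-vector x i) l ⟨
    Σℤ n (λ j → xI-A x l j * minor-vector x i j)
      ≡⟨ Σ-cong n (λ j → trans (*-comm (xI-A x l j) (minor-vector x i j)) (cong (minor-vector x i j *_) (xI-A-sym x l j))) ⟩
    Σℤ n (λ j → minor-vector x i j * xI-A x j l)
      ≡⟨ adjugate-row (xI-A x) i l ⟩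
    charPoly G x * δ i l
      ≡⟨ cong (charPoly G x *_) (δ-sym i l) ⟩
    charPoly G x * e i l ∎))
    where open ≡-Reasoning

  module _ (k : ℕ) (regular : Regular k G) where

    column-sum : ∀ j → Σℤ n (λ i → A G i j) ≡ + k
    column-sum j = trans (Σ-cong n (λ i → A-sym i j)) (regular j)

    -- By the adjugate, the multiple of `e i` by the value of the characteristic polynomial at x
    -- lies in the image of A - x. It is congruent to `F (e i)` modulo this image, so `F (e i)` lies
    -- in the image for every x.
    cayley-hamilton : ∀ {F} → Represents (A G) (charPoly G) F → ∀ i → F (e i) ≗0
    cayley-hamilton {F} R i = divisible-by-all (A G) (+ k) A-abs column-sum (F (e i)) λ x →
      let w , P = reduceAt R x (e i) in
      (λ l → w l + - + 1 * minor-vector x i l) , λ l →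
        trans (T-linear (A G) x (- + 1) w (minor-vector x i) l)
          (trans (cong (λ t → T (A G) x w l + - + 1 * t) (trans (T-minor-vector x i l) (cong -_ (P l))))
            (shape (T (A G) x w l) (F (e i) l)))
      where
      shape : ∀ t f → t + - + 1 * - (f - t) ≡ f
      shape = solve-∀

    total-T : ∀ θ v → Σℤ n (T (A G) θ v) ≡ (+ k - θ) * Σℤ n v
    total-T θ v = begin
      Σℤ n (λ i → (A G ∙ v) i - θ * v i)         ≡⟨ Σ-cong n (λ i → minus ((A G ∙ v) i) θ (v i)) ⟩
      Σℤ n (λ i → (A G ∙ v) i + - θ * v i)       ≡⟨ Σ-linear n (- θ) (A G ∙ v) v ⟩
      Σℤ n (A G ∙ v) + - θ * Σℤ n v              ≡⟨ cong (_+ - θ * Σℤ n v) total ⟩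
      + k * Σℤ n v + - θ * Σℤ n v                ≡⟨ collect (+ k) θ (Σℤ n v) ⟩
      (+ k - θ) * Σℤ n v                         ∎
      where
      open ≡-Reasoning
      minus : ∀ a θ v → a - θ * v ≡ a + - θ * v
      minus = solve-∀
      collect : ∀ k θ v → k * v + - θ * v ≡ (k - θ) * v
      collect = solve-∀
      total : Σℤ n (A G ∙ v) ≡ + k * Σℤ n v
      total = begin
        Σℤ n (λ i → Σℤ n (λ j → A G i j * v j))  ≡⟨ Σ-swap n n (λ i j → A G i j * v j) ⟩
        Σℤ n (λ j → Σℤ n (λ i → A G i j * v j))  ≡⟨ Σ-cong n (λ j → trans (Σ-*ʳ n (λ i → A G i j) (v j)) (cong (_* v j) (column-sum j))) ⟩
        Σℤ n (λ j → + k * v j)                   ≡⟨ Σ-*ˡ n (+ k) v ⟩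
        + k * Σℤ n v                             ∎

    T-const : ∀ θ c i → T (A G) θ (λ _ → c) i ≡ (+ k - θ) * c
    T-const θ c i = trans (cong (_- θ * c) (trans (Σ-*ʳ n (A G i) c) (cong (_* c) (regular i)))) (shape (+ k) θ c)
      where
      shape : ∀ k θ c → k * c - θ * c ≡ (k - θ) * c
      shape = solve-∀

    -- The Dirichlet form Σ A_ij (v_i - v_j)² vanishes on the k-eigenspace.
    kernel-constant : Connected G → ∀ v → T (A G) (+ k) v ≗0 → ∀ i j → v i ≡ v j
    kernel-constant connected v Tv≗0 i j = along (connected i j)
      where
      form : Fin n → Fin n → ℤ
      form i j = A G i j * ((v i - v j) * (v i - v j))
      row : ∀ i → Σℤ n (form i) ≡ Σℤ n (λ j → A G i j * (v j * v j)) + - + k * (v i * v i)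
      row i = begin
        Σℤ n (form i)
          ≡⟨ Σ-cong n (λ j → shape (A G i j) (v i) (v j)) ⟩
        Σℤ n (λ j → A G i j * (v j * v j) + v i * (A G i j * v i + - + 2 * (A G i j * v j)))
          ≡⟨ Σ-linear n (v i) (λ j → A G i j * (v j * v j)) (λ j → A G i j * v i + - + 2 * (A G i j * v j)) ⟩
        Q + v i * Σℤ n (λ j → A G i j * v i + - + 2 * (A G i j * v j))
          ≡⟨ cong (λ t → Q + v i * t) (Σ-linear n (- + 2) (λ j → A G i j * v i) (λ j → A G i j * v j)) ⟩
        Q + v i * (Σℤ n (λ j → A G i j * v i) + - + 2 * (A G ∙ v) i)
          ≡⟨ cong₂ (λ s t → Q + v i * (s + - + 2 * t)) (trans (Σ-*ʳ n (A G i) (v i)) (cong (_* v i) (regular i))) (i-j≡0⇒i≡j _ _ (Tv≗0 i)) ⟩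
        Q + v i * (+ k * v i + - + 2 * (+ k * v i))
          ≡⟨ cong (λ t → Q + t) (shape₂ (+ k) (v i)) ⟩
        Q + - + k * (v i * v i) ∎
        where
        open ≡-Reasoning
        Q = Σℤ n (λ j → A G i j * (v j * v j))
        shape : ∀ a x y → a * ((x - y) * (x - y)) ≡ a * (y * y) + x * (a * x + - + 2 * (a * y))
        shape = solve-∀
        shape₂ : ∀ k x → x * (k * x + - + 2 * (k * x)) ≡ - k * (x * x)
        shape₂ = solve-∀
      total : Σℤ n (λ i → Σℤ n (form i)) ≡ + 0
      total = begin
        Σℤ n (λ i → Σℤ n (form i))
          ≡⟨ Σ-cong n row ⟩
        Σℤ n (λ i → (A G ∙ (λ j → v j * v j)) i + - + k * (v i * v i))
          ≡⟨ Σ-cong n (λ i → minus ((A G ∙ (λ j → v j * v j)) i) (+ k) (v i * v i)) ⟩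
        Σℤ n (T (A G) (+ k) (λ i → v i * v i))
          ≡⟨ total-T (+ k) (λ i → v i * v i) ⟩
        (+ k - + k) * Σℤ n (λ i → v i * v i)
          ≡⟨ cong (_* Σℤ n (λ i → v i * v i)) (+-inverseʳ (+ k)) ⟩
        + 0 ∎
        where
        open ≡-Reasoning
        minus : ∀ a k x → a + - k * x ≡ a - k * x
        minus = solve-∀
      form-nonneg : ∀ i j → + 0 ≤ form i j
      form-nonneg i j with adj G i j
      ... | true  = subst (+ 0 ≤_) (sym (*-identityˡ _)) (square-nonneg (v i - v j))
      ... | false = ≤-refl
      form-zero : ∀ i j → form i j ≡ + 0
      form-zero i = Σ-nonneg-zero n (form-nonneg i) (Σ-nonneg-zero n (λ i → Σ-nonneg n (form-nonneg i)) total i)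
      edge : ∀ {i j} → adj G i j ≡ true → v i ≡ v j
      edge {i} {j} ij = i-j≡0⇒i≡j (v i) (v j) (reduce (i*j≡0⇒i≡0∨j≡0 (v i - v j)
        (trans (sym (*-identityˡ _)) (trans (cong (λ b → (if b then + 1 else + 0) * ((v i - v j) * (v i - v j))) (sym ij)) (form-zero i j)))))
      along : ∀ {i j} → Reach G i j → v i ≡ v j
      along here          = refl
      along (step ij jl)  = trans (edge ij) (along jl)

-- Graphs with a simple eigenvalue -1

^-mod : ∀ {h} a b m → a ≡ b [mod h ] → a ^ m ≡ b ^ m [mod h ]
^-mod a b zero    _ = mod-reflexive {x = + 1} refl
^-mod a b (suc m) p = *-mod a b (a ^ m) (b ^ m) p (^-mod a b m p)

Σ-δ-one : ∀ {n} (i : Fin n) → Σℤ n (δ i) ≡ + 1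
Σ-δ-one {n} i = trans (Σ-cong n (λ j → sym (*-identityˡ (δ i j)))) (Σ-δ (λ _ → + 1) i)

module _ {n} (G : Graph n) (k m r : ℕ) (α β : ℤ) (-1≢α : - + 1 ≢ α) (-1≢β : - + 1 ≢ β) (spectrum : HasSpectrum G (+ k) α β m r) where

  singular : charPoly G (- + 1) ≡ + 0
  singular = trans (spectrum (- + 1)) (shape (- + 1 - + k) ((- + 1 - α) ^ m) ((- + 1 - β) ^ r))
    where
    shape : ∀ u s t → u * + 0 * s * t ≡ + 0
    shape = solve-∀

  -- If all these minors vanish, h² divides the value h q(-1 + h) of the characteristic polynomial
  -- at -1 + h, so h divides q(-1 + h) and with it q(-1). But q(-1) is nonzero and h = 1 + |q(-1)|.
  -- Working modulo h² plays the part of the derivative at -1.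
  simple-root-minor : ∃ λ i → det n (xI-A G (- + 1) [ i ← e i ]) ≢ + 0
  simple-root-minor = ¬∀⟶∃¬ n _ (λ i → det n (xI-A G (- + 1) [ i ← e i ]) ≟ℤ + 0) λ minors →
    contradiction (ℕ.∣⇒≤ {{ℕ.≢-nonZero (q₀≢0 ∘ ∣i∣≡0⇒i≡0)}} (∣⇒∣ᵤ (h∣q₀ minors))) (ℕ.<-irrefl refl)
    where
    q : ℤ → ℤ
    q x = (x - + k) * (x - α) ^ m * (x - β) ^ r
    q₀ h : ℤ
    q₀ = q (- + 1)
    h = + suc ∣ q₀ ∣
    -1-root : ∀ {θ} → - + 1 ≢ θ → - + 1 - θ ≢ + 0
    -1-root ≢θ eq = ≢θ (i-j≡0⇒i≡j _ _ eq)
    q₀≢0 : q₀ ≢ + 0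
    q₀≢0 = product-nonzero (product-nonzero (-1-root {+ k} λ ()) (pow-nonzero (- + 1 - α) m (-1-root -1≢α))) (pow-nonzero (- + 1 - β) r (-1-root -1≢β))
    factor : charPoly G (- + 1 + h) ≡ h * q (- + 1 + h)
    factor = trans (spectrum (- + 1 + h)) (shape h (- + 1 + h - + k) ((- + 1 + h - α) ^ m) ((- + 1 + h - β) ^ r))
      where
      shape : ∀ h u s t → u * (- + 1 + h + + 1) * s * t ≡ h * (u * s * t)
      shape = solve-∀
    linear : ∀ θ → - + 1 + h - θ ≡ - + 1 - θ [mod h ]
    linear θ = divides (+ 1) (shape h θ)
      where
      shape : ∀ h θ → (- + 1 + h - θ) - (- + 1 - θ) ≡ + 1 * h
      shape = solve-∀
    q-mod : q (- + 1 + h) ≡ q₀ [mod h ]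
    q-mod = *-mod ((- + 1 + h - + k) * (- + 1 + h - α) ^ m) ((- + 1 - + k) * (- + 1 - α) ^ m) ((- + 1 + h - β) ^ r) ((- + 1 - β) ^ r)
      (*-mod (- + 1 + h - + k) (- + 1 - + k) ((- + 1 + h - α) ^ m) ((- + 1 - α) ^ m) (linear (+ k)) (^-mod (- + 1 + h - α) (- + 1 - α) m (linear α)))
      (^-mod (- + 1 + h - β) (- + 1 - β) r (linear β))
    module _ (minors : ∀ i → det n (xI-A G (- + 1) [ i ← e i ]) ≡ + 0) where
      h²∣charPoly : h * h ∣ charPoly G (- + 1 + h)
      h²∣charPoly = subst (h * h ∣_) (det-cong n (xI-A-shift G (- + 1) h)) (h²∣det h (xI-A G (- + 1)) minors
        singular)
      h∣q : h ∣ q (- + 1 + h)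
      h∣q = *-cancelˡ-∣ h (subst (h * h ∣_) factor h²∣charPoly)
      h∣q₀ : h ∣ q₀
      h∣q₀ = subst (h ∣_) (shape (q (- + 1 + h)) q₀) (∣m∣n⇒∣m-n h∣q q-mod)
        where
        shape : ∀ x y → x - (x - y) ≡ y
        shape = solve-∀

  module _ (connected : Connected G) (regular : Regular k G) where

    private
      T′ : ℤ → Vector n → Vector n
      T′ = T (A G)

    C : Vector n → Vector n
    C v = T′ β (T′ α v)

    charPoly-represents : Represents (A G) (charPoly G) (T′ (+ k) ∘ T′ (- + 1) ∘ pow (A G) α m ∘ pow (A G) β r)
    charPoly-represents = represents λ x v →
      let w , P = reduceAt product x v in w , λ i → trans (cong (_* v i) (spectrum x)) (P i)
      where
      product = represents-∘ (A G) (represents-∘ (A G) (represents-∘ (A G) (represents-T (A G) (+ k)) (represents-T (A G) (- + 1)))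
        (represents-pow (A G) α m)) (represents-pow (A G) β r)

    -- Cayley-Hamilton gives this relation with the powers `m` and `r`. Each power is commuted to
    -- the outside, where the symmetry of A replaces it by a single factor.
    minimal-polynomial : ∀ i → T′ (+ k) (T′ (- + 1) (C (e i))) ≗0
    minimal-polynomial i l = begin
      T′ (+ k) (T′ (- + 1) (T′ β (T′ α v))) l  ≡⟨ T-cong S (+ k) (T-comm S (- + 1) β (T′ α v)) l ⟩
      T′ (+ k) (T′ β (T′ (- + 1) (T′ α v))) l  ≡⟨ T-comm S (+ k) β (T′ (- + 1) (T′ α v)) l ⟩
      T′ β (T′ (+ k) (T′ (- + 1) (T′ α v))) l  ≡⟨ T-cong S β (T-cong S (+ k) (T-comm S (- + 1) α v)) l ⟩
      T′ β (T′ (+ k) (T′ α (T′ (- + 1) v))) l  ≡⟨ T-cong S β (T-comm S (+ k) α (T′ (- + 1) v)) l ⟩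
      T′ β (T′ α (T′ (+ k) (T′ (- + 1) v))) l  ≡⟨ without-powers l ⟩
      + 0 ∎
      where
      open ≡-Reasoning
      S : Matrix n
      S = A G
      v : Vector n
      v = e i
      inner : ∀ θ j u → T′ (+ k) (T′ (- + 1) (pow S θ j u)) ≗ pow S θ j (T′ (+ k) (T′ (- + 1) u))
      inner θ j u l = trans (T-cong S (+ k) (T-pow-comm S (- + 1) θ j u) l) (T-pow-comm S (+ k) θ j (T′ (- + 1) u) l)
      without-α : T′ α (T′ (+ k) (T′ (- + 1) (pow S β r v))) ≗0
      without-α = pow-reduced S (A-sym G) α m _ λ l → trans (sym (inner α m (pow S β r v) l)) (cayley-hamilton G k regular charPoly-represents i l)
      without-powers : T′ β (T′ α (T′ (+ k) (T′ (- + 1) v))) ≗0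
      without-powers = pow-reduced S (A-sym G) β r _ λ l → trans (sym (trans (T-cong S α (inner β r v) l) (T-pow-comm S α β r _ l))) (without-α l)

    C-self-adjoint : ∀ u v → C u · v ≡ u · C v
    C-self-adjoint u v = begin
      T′ β (T′ α u) · v  ≡⟨ T-self-adjoint (A G) (A-sym G) β (T′ α u) v ⟩
      T′ α u · T′ β v    ≡⟨ T-self-adjoint (A G) (A-sym G) α u (T′ β v) ⟩
      u · T′ α (T′ β v)  ≡⟨ Σ-cong n (λ i → cong (u i *_) (T-comm (A G) α β v i)) ⟩
      u · C v            ∎
      where open ≡-Reasoning

    C-sym : ∀ i j → C (e i) j ≡ C (e j) i
    C-sym i j = trans (sym (·-e j (C (e i)))) (trans (C-self-adjoint (e i) (e j)) (e-· i (C (e j))))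

    T-C-sym : ∀ i j → T′ (- + 1) (C (e i)) j ≡ T′ (- + 1) (C (e j)) i
    T-C-sym i j = begin
      T′ (- + 1) (C (e i)) j        ≡⟨ ·-e j (T′ (- + 1) (C (e i))) ⟨
      T′ (- + 1) (C (e i)) · e j    ≡⟨ T-self-adjoint (A G) (A-sym G) (- + 1) (C (e i)) (e j) ⟩
      C (e i) · T′ (- + 1) (e j)    ≡⟨ C-self-adjoint (e i) (T′ (- + 1) (e j)) ⟩
      e i · C (T′ (- + 1) (e j))    ≡⟨ e-· i (C (T′ (- + 1) (e j))) ⟩
      C (T′ (- + 1) (e j)) i        ≡⟨ T-cong (A G) β (T-comm (A G) α (- + 1) (e j)) i ⟩
      T′ β (T′ (- + 1) (T′ α (e j))) i ≡⟨ T-comm (A G) β (- + 1) (T′ α (e j)) i ⟩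
      T′ (- + 1) (C (e j)) i        ∎
      where open ≡-Reasoning

    -- The scaled projection to the (-1)-eigenspace

    module _ (i : Fin n) (minor≢0 : det n (xI-A G (- + 1) [ i ← e i ]) ≢ + 0) where

      K ab c δ₀ : ℤ
      K = + k + + 1
      ab = (+ 1 + α) * (+ 1 + β)
      c = T′ (- + 1) (C (e i)) i

      -- d j is K ab times the projection of e j to the (-1)-eigenspace.
      d : Fin n → Vector n
      d j l = K * C (e j) l + - c * + 1
      δ₀ = d i i

      K≢0 : K ≢ + 0
      K≢0 eq = contradiction (trans (+-comm (+ 1) (+ k)) eq) λ ()

      ab≢0 : ab ≢ + 0
      ab≢0 = product-nonzero (1+≢0 -1≢α) (1+≢0 -1≢β)
        where
        1+≢0 : ∀ {θ} → - + 1 ≢ θ → + 1 + θ ≢ + 0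
        1+≢0 {θ} ≢θ eq = ≢θ (sym (trans (shape θ) (cong (_- + 1) eq)))
          where
          shape : ∀ θ → θ ≡ + 1 + θ - + 1
          shape = solve-∀

      -- Every column of (A + 1) C is constant, being in the k-eigenspace of a connected graph; a
      -- symmetric matrix with constant columns has all entries equal.
      T-C-constant : ∀ j l → T′ (- + 1) (C (e j)) l ≡ c
      T-C-constant j l = trans (constant j l i) (trans (T-C-sym j i) (constant i j i))
        where
        constant : ∀ j → ∀ l l′ → T′ (- + 1) (C (e j)) l ≡ T′ (- + 1) (C (e j)) l′
        constant j = kernel-constant G k regular connected (T′ (- + 1) (C (e j))) (minimal-polynomial j)

      T-d : ∀ j → T′ (- + 1) (d j) ≗0
      T-d j l = begin
        T′ (- + 1) (d j) l
          ≡⟨ T-linear (A G) (- + 1) (- c) (λ l → K * C (e j) l) (λ _ → + 1) l ⟩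
        T′ (- + 1) (λ l → K * C (e j) l) l + - c * T′ (- + 1) (λ _ → + 1) l
          ≡⟨ cong₂ (λ x y → x + - c * y)
               (trans (T-scale (A G) (- + 1) K (C (e j)) l) (cong (K *_) (T-C-constant j l))) (T-const G k regular (- + 1) (+ 1) l) ⟩
        K * c + - c * (K * + 1)
          ≡⟨ shape K c ⟩
        + 0 ∎
        where
        open ≡-Reasoning
        shape : ∀ K c → K * c + - c * (K * + 1) ≡ + 0
        shape = solve-∀

      Σ-d : ∀ j → Σℤ n (d j) ≡ + 0
      Σ-d j = *-cancelˡ-zero K (Σℤ n (d j)) K≢0 (trans (sym (total-T G k regular (- + 1) (d j))) (Σ-zero n (T-d j)))

      C-d : ∀ j l → C (d j) l ≡ ab * d j l
      C-d j l = begin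
        T′ β (T′ α (d j)) l                    ≡⟨ T-cong (A G) β (eigen α) l ⟩
        T′ β (λ l → (- + 1 - α) * d j l) l     ≡⟨ T-scale (A G) β (- + 1 - α) (d j) l ⟩
        (- + 1 - α) * T′ β (d j) l             ≡⟨ cong ((- + 1 - α) *_) (eigen β l) ⟩
        (- + 1 - α) * ((- + 1 - β) * d j l)    ≡⟨ shape α β (d j l) ⟩
        ab * d j l                             ∎
        where
        open ≡-Reasoning
        eigen : ∀ θ l → T′ θ (d j) l ≡ (- + 1 - θ) * d j l
        eigen θ l = trans (shape θ ((A G ∙ d j) l) (d j l)) (trans (cong (_+ (- + 1 - θ) * d j l) (T-d j l)) (+-identityˡ _))
          where
          shape : ∀ θ s v → s - θ * v ≡ (s - - + 1 * v) + (- + 1 - θ) * v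
          shape = solve-∀
        shape : ∀ α β v → (- + 1 - α) * ((- + 1 - β) * v) ≡ (+ 1 + α) * (+ 1 + β) * v
        shape = solve-∀

      -- The diagonal entry of D² = K ab D: replace one factor by its definition, use that C acts on
      -- `d i` as ab, and that `d i` is orthogonal to the constants.
      d-·-d : d i · d i ≡ K * (ab * δ₀)
      d-·-d = begin
        Σℤ n (λ l → d i l * d i l)
          ≡⟨ Σ-cong n (λ l → shape K (C (e i) l) c (d i l)) ⟩
        Σℤ n (λ l → K * (C (e i) l * d i l) + - c * d i l)
          ≡⟨ Σ-linear n (- c) (λ l → K * (C (e i) l * d i l)) (d i) ⟩
        Σℤ n (λ l → K * (C (e i) l * d i l)) + - c * Σℤ n (d i)
          ≡⟨ cong₂ (λ x y → x + - c * y) (Σ-*ˡ n K (λ l → C (e i) l * d i l)) (Σ-d i) ⟩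
        K * (C (e i) · d i) + - c * + 0
          ≡⟨ cong₂ (λ x y → K * x + y) (trans (C-self-adjoint (e i) (d i)) (trans (e-· i (C (d i))) (C-d i i))) (*-zeroʳ (- c)) ⟩
        K * (ab * δ₀) + + 0
          ≡⟨ +-identityʳ _ ⟩
        K * (ab * δ₀) ∎
        where
        open ≡-Reasoning
        shape : ∀ K x c y → (K * x + - c * + 1) * y ≡ K * (x * y) + - c * y
        shape = solve-∀

      -- The entries of A²; for distinct vertices, the number of common neighbours.
      walks : Fin n → Fin n → ℤ
      walks l j = Σℤ n (λ t → A G l t * A G t j)

      C-entry : ∀ j l → C (e j) l ≡ walks l j - (α + β) * A G l j + α * β * δ l j
      C-entry j l = begin
        T′ β (T′ α (e j)) l
          ≡⟨ T-T (A G) β α (e j) l ⟩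
        ((A G ∙ (A G ∙ e j)) l - α * (A G ∙ e j) l) - β * ((A G ∙ e j) l - α * δ l j)
          ≡⟨ cong₂ (λ x y → (x - α * y) - β * (y - α * δ l j)) (∙-cong (A G) column l) (column l) ⟩
        (walks l j - α * A G l j) - β * (A G l j - α * δ l j)
          ≡⟨ shape α β (walks l j) (A G l j) (δ l j) ⟩
        walks l j - (α + β) * A G l j + α * β * δ l j ∎
        where
        open ≡-Reasoning
        column : A G ∙ e j ≗ (λ t → A G t j)
        column t = ·-e j (A G t)
        shape : ∀ α β w a x → (w - α * a) - β * (a - α * x) ≡ w - (α + β) * a + α * β * x
        shape = solve-∀

      C-diagonal : ∀ j → C (e j) j ≡ + k + α * β
      C-diagonal j = trans (C-entry j j) (trans (cong₂ (λ w z → w - (α + β) * proj₁ z + α * β * proj₂ z) closed (cong₂ _,_ (A-loopless G j) (δ-refl j))) (shape (+ k) (α + β) (α * β)))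
        where
        closed : walks j j ≡ + k
        closed = trans (Σ-cong n (λ t → trans (cong (A G j t *_) (A-sym G t j)) (A-idempotent G j t))) (regular j)
        shape : ∀ k s p → k - s * + 0 + p * + 1 ≡ k + p
        shape = solve-∀

      d-diagonal : ∀ j → d j j ≡ δ₀
      d-diagonal j = cong (λ x → K * x + - c * + 1) (trans (C-diagonal j) (sym (C-diagonal i)))

      d-sym : ∀ j l → d j l ≡ d l j
      d-sym j l = cong (λ x → K * x + - c * + 1) (C-sym j l)

      -- If δ₀ = 0 then `d i` has length 0 and vanishes. This makes a nonzero multiple of `e i` a
      -- value of the singular matrix -1 - A, and by `cramer` the minor at `i` is zero.
      δ₀≢0 : δ₀ ≢ + 0
      δ₀≢0 δ₀≡0 = product-nonzero (product-nonzero (product-nonzero K≢0 K≢0) ab≢0) minor≢0 (begin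
        K * K * ab * det n (M [ i ← e i ])                 ≡⟨ det-set-scale M i (K * K * ab) (e i) ⟨
        det n (M [ i ← (λ r → K * K * ab * e i r) ])
          ≡⟨ det-cong n (λ r l → cong (λ t → if does (l ≟ i) then t else M r l) (sym (M-v r))) ⟩
        det n (M [ i ← M ∙ v ])                            ≡⟨ cramer n M v i ⟩
        charPoly G (- + 1) * v i                           ≡⟨ cong (_* v i) singular ⟩
        + 0 ∎)
        where
        open ≡-Reasoning
        M : Matrix n
        M = xI-A G (- + 1)
        v : Vector n
        -- From (x - α)(x - β) - ab = (x + 1)(x - (α + β + 1)); the constant vector supplies the J
        -- part, so that `M ∙ v` is K² ab `e i` - K `d i`.
        v l = K * K * T′ (α + β + + 1) (e i) l + - c * + 1
        d≗0 : d i ≗0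
        d≗0 = ·-definite (d i) (trans d-·-d (trans (cong (λ x → K * (ab * x)) δ₀≡0) (shape K ab)))
          where
          shape : ∀ x y → x * (y * + 0) ≡ + 0
          shape = solve-∀
        T-T-C : ∀ l → T′ (- + 1) (T′ (α + β + + 1) (e i)) l ≡ C (e i) l - ab * e i l
        T-T-C l = trans (T-T (A G) (- + 1) (α + β + + 1) (e i) l)
          (trans (shape α β ((A G ∙ (A G ∙ e i)) l) ((A G ∙ e i) l) (e i l)) (cong (_- ab * e i l) (sym (T-T (A G) β α (e i) l))))
          where
          shape : ∀ α β ss s x → (ss - (α + β + + 1) * s) - - + 1 * (s - (α + β + + 1) * x)
            ≡ ((ss - α * s) - β * (s - α * x)) - (+ 1 + α) * (+ 1 + β) * x
          shape = solve-∀
        M-v : ∀ l → (M ∙ v) l ≡ K * K * ab * e i l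
        M-v l = begin
          (M ∙ v) l
            ≡⟨ xI-A-∙ G (- + 1) v l ⟩
          - T′ (- + 1) v l
            ≡⟨ cong -_ (T-linear (A G) (- + 1) (- c) (λ l → K * K * T′ (α + β + + 1) (e i) l) (λ _ → + 1) l) ⟩
          - (T′ (- + 1) (λ l → K * K * T′ (α + β + + 1) (e i) l) l + - c * T′ (- + 1) (λ _ → + 1) l)
            ≡⟨ cong₂ (λ x y → - (x + - c * y)) (trans (T-scale (A G) (- + 1) (K * K) (T′ (α + β + + 1) (e i)) l) (cong (K * K *_) (T-T-C l)))
                 (T-const G k regular (- + 1) (+ 1) l) ⟩
          - (K * K * (C (e i) l - ab * e i l) + - c * (K * + 1))
            ≡⟨ shape K (C (e i) l) ab (e i l) c ⟩
          K * K * ab * e i l - K * d i l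
            ≡⟨ cong (λ x → K * K * ab * e i l - K * x) (d≗0 l) ⟩
          K * K * ab * e i l - K * + 0
            ≡⟨ shape₂ (K * K * ab * e i l) K ⟩
          K * K * ab * e i l ∎
          where
          shape : ∀ K x ab y c → - (K * K * (x - ab * y) + - c * (K * + 1)) ≡ K * K * ab * y - K * (K * x + - c * + 1)
          shape = solve-∀
          shape₂ : ∀ x K → x - K * + 0 ≡ x
          shape₂ = solve-∀

      -- The combination of `d j` and `d i` that vanishes at `i` lies in the kernel of A + 1, hence
      -- is zero; its entry at `j` is the difference of the two squares.
      d-squares : ∀ j → d i j * d i j ≡ δ₀ * δ₀
      d-squares j = i-j≡0⇒i≡j _ _ (trans (shape δ₀ (d i j)) (cong -_ (trans (sym at-j) (kernel-vanishing M i (e i) minor≢0 v M-v at-i j))))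
        where
        M : Matrix n
        M = xI-A G (- + 1)
        v : Vector n
        v l = δ₀ * d j l + - d j i * d i l
        shape : ∀ x y → y * y - x * x ≡ - (x * x + - y * y)
        shape = solve-∀
        at-j : v j ≡ δ₀ * δ₀ + - d i j * d i j
        at-j = cong₂ (λ x y → δ₀ * x + - y * d i j) (d-diagonal j) (d-sym j i)
        at-i : v i ≡ + 0
        at-i = cancel δ₀ (d j i)
          where
          cancel : ∀ x y → x * y + - y * x ≡ + 0
          cancel = solve-∀
        M-v : ∀ l → (M ∙ v) l ≡ + 0
        M-v l = trans (xI-A-∙ G (- + 1) v l) (cong -_ (trans (T-linear (A G) (- + 1) (- d j i) (λ l → δ₀ * d j l) (d i) l)
          (trans (cong₂ (λ x y → x + - d j i * y) (trans (T-scale (A G) (- + 1) δ₀ (d j) l) (cong (δ₀ *_) (T-d j l))) (T-d i l)) (vanish δ₀ (d j i)))))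
          where
          vanish : ∀ x y → x * + 0 + - y * + 0 ≡ + 0
          vanish = solve-∀

      d-signs : ∀ j → d i j ≡ δ₀ ⊎ d i j ≡ - δ₀
      d-signs j = equal-squares (d i j) δ₀ (d-squares j)

      -- The trace of K ab times a projection of rank one. It is read off from the squared length of
      -- `d i`, which is both n δ₀² and K ab δ₀.
      n*δ₀ : + n * δ₀ ≡ K * ab
      n*δ₀ = i-j≡0⇒i≡j (+ n * δ₀) (K * ab) (*-cancelˡ-zero δ₀ (+ n * δ₀ - K * ab) δ₀≢0
        (trans (shape δ₀ (+ n) K ab) (i≡j⇒i-j≡0 (trans (sym (Σ-const n (δ₀ * δ₀))) (trans (Σ-cong n (λ j → sym (d-squares j))) d-·-d)))))
        where
        shape : ∀ x n K y → x * (n * x - K * y) ≡ n * (x * x) - K * (y * x)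
        shape = solve-∀

      -- Sum column `i` of (A + 1) C = c J: the columns of a polynomial in A sum to its value at k.
      n*c : + n * c ≡ K * ((+ k - β) * (+ k - α))
      n*c = begin
        + n * c                                            ≡⟨ Σ-const n c ⟨
        Σℤ n (λ _ → c)                                     ≡⟨ Σ-cong n (T-C-constant i) ⟨
        Σℤ n (T′ (- + 1) (C (e i)))                        ≡⟨ total-T G k regular (- + 1) (C (e i)) ⟩
        K * Σℤ n (C (e i))                                 ≡⟨ cong (K *_) (total-T G k regular β (T′ α (e i))) ⟩
        K * ((+ k - β) * Σℤ n (T′ α (e i)))                ≡⟨ cong (λ x → K * ((+ k - β) * x)) (total-T G k regular α (e i)) ⟩
        K * ((+ k - β) * ((+ k - α) * Σℤ n (e i)))         ≡⟨ cong (λ x → K * ((+ k - β) * ((+ k - α) * x))) Σ-e ⟩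
        K * ((+ k - β) * ((+ k - α) * + 1))                ≡⟨ cong (λ x → K * ((+ k - β) * x)) (*-identityʳ (+ k - α)) ⟩
        K * ((+ k - β) * (+ k - α))                        ∎
        where
        open ≡-Reasoning
        Σ-e : Σℤ n (e i) ≡ + 1
        Σ-e = trans (Σ-cong n (λ j → δ-sym j i)) (Σ-δ-one i)

      δ₀-value : δ₀ ≡ K * (+ k + α * β) - c
      δ₀-value = trans (cong (λ x → K * x + - c * + 1) (C-diagonal i)) (shape (K * (+ k + α * β)) c)
        where
        shape : ∀ x c → x + - c * + 1 ≡ x - c
        shape = solve-∀

      -- The trace of C in two ways: its diagonal entries are k + αβ, and its eigenvalues are (k -
      -- α)(k - β), ab and zeros.
      parameter-equation : + n * (+ k + α * β) ≡ (+ k - α) * (+ k - β) + ab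
      parameter-equation = i-j≡0⇒i≡j (+ n * (+ k + α * β)) ((+ k - α) * (+ k - β) + ab)
        (*-cancelˡ-zero K (+ n * (+ k + α * β) - ((+ k - α) * (+ k - β) + ab)) K≢0 (trans (shape K (+ n) (+ k) α β ab c)
        (cong₂ _-_ (i≡j⇒i-j≡0 (trans (cong (+ n *_) (sym δ₀-value)) n*δ₀)) (cong -_ (i≡j⇒i-j≡0 n*c)))))
        where
        shape : ∀ K n k α β x c → K * (n * (k + α * β) - ((k - α) * (k - β) + x))
          ≡ (n * (K * (k + α * β) - c) - K * x) - - (n * c - K * ((k - β) * (k - α)))
        shape = solve-∀

      -- Signs in row i and common neighbours

      k<n : + k + + 1 ≤ + n
      k<n = 0≤i-j⇒j≤i (subst (+ 0 ≤_) total (Σ-nonneg n nonneg))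
        where
        -- The summand is the indicator of the vertices neither equal nor adjacent to `i`.
        nonneg : ∀ l → + 0 ≤ + 1 + - + 1 * (A G i l + + 1 * δ i l)
        nonneg l with i ≟ l
        ... | yes refl = subst (λ a → + 0 ≤ + 1 + - + 1 * (a + + 1)) (sym (A-loopless G i)) ≤-refl
        ... | no _ with adj G i l
        ...   | true  = ≤-refl
        ...   | false = +≤+ ℕ.z≤n
        total : Σℤ n (λ l → + 1 + - + 1 * (A G i l + + 1 * δ i l)) ≡ + n - (+ k + + 1)
        total = begin
          Σℤ n (λ l → + 1 + - + 1 * (A G i l + + 1 * δ i l))
            ≡⟨ Σ-linear n (- + 1) (λ _ → + 1) (λ l → A G i l + + 1 * δ i l) ⟩
          Σℤ n (λ _ → + 1) + - + 1 * Σℤ n (λ l → A G i l + + 1 * δ i l)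
            ≡⟨ cong₂ (λ x y → x + - + 1 * y) (Σ-const n (+ 1))
                 (trans (Σ-linear n (+ 1) (A G i) (δ i)) (cong₂ (λ x y → x + + 1 * y) (regular i) (Σ-δ-one i))) ⟩
          + n * + 1 + - + 1 * (+ k + + 1)
            ≡⟨ shape (+ n) (+ k) ⟩
          + n - (+ k + + 1) ∎
          where
          open ≡-Reasoning
          shape : ∀ n k → n * + 1 + - + 1 * (k + + 1) ≡ n - (k + + 1)
          shape = solve-∀

      -- The entries of `d i` over the neighbours of `i` sum to -δ₀. If all of them were -δ₀, the
      -- sum would be -k δ₀.
      neighbour : + k ≢ + 1 → ∃ λ l → A G i l ≡ + 1 × d i l ≡ δ₀
      neighbour k≢1 =
        let l , ≢0 = ¬∀⟶∃¬ n (λ l → A G i l * (d i l + δ₀) ≡ + 0) (λ l → A G i l * (d i l + δ₀) ≟ℤ + 0) ¬all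
        in l , A-nonzero G i l (λ a≡0 → ≢0 (cong (_* (d i l + δ₀)) a≡0)) , d≡δ₀ l ≢0 (d-signs l)
        where
        ¬all : ¬ (∀ l → A G i l * (d i l + δ₀) ≡ + 0)
        ¬all all = k≢1 (i-j≡0⇒i≡j (+ k) (+ 1) (*-cancelˡ-zero δ₀ (+ k - + 1) δ₀≢0 (begin
          δ₀ * (+ k - + 1)
            ≡⟨ shape δ₀ (+ k) ((A G ∙ d i) i) ⟩
          ((A G ∙ d i) i + δ₀ * + k) - ((A G ∙ d i) i - - + 1 * δ₀)
            ≡⟨ cong₂ _-_ (trans (sym total) (Σ-zero n all)) (T-d i i) ⟩
          + 0 ∎)))
          where
          open ≡-Reasoning
          shape : ∀ x k s → x * (k - + 1) ≡ (s + x * k) - (s - - + 1 * x)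
          shape = solve-∀
          total : Σℤ n (λ l → A G i l * (d i l + δ₀)) ≡ (A G ∙ d i) i + δ₀ * + k
          total = trans (Σ-cong n (λ l → expand (A G i l) (d i l) δ₀))
            (trans (Σ-linear n δ₀ (λ l → A G i l * d i l) (A G i)) (cong (λ x → (A G ∙ d i) i + δ₀ * x) (regular i)))
            where
            expand : ∀ a x y → a * (x + y) ≡ a * x + y * a
            expand = solve-∀
        d≡δ₀ : ∀ l → A G i l * (d i l + δ₀) ≢ + 0 → d i l ≡ δ₀ ⊎ d i l ≡ - δ₀ → d i l ≡ δ₀
        d≡δ₀ l _  (inj₁ eq) = eq
        d≡δ₀ l ≢0 (inj₂ eq) = contradiction (trans (cong (λ x → A G i l * (x + δ₀)) eq)
          (trans (cong (A G i l *_) (+-inverseˡ δ₀)) (*-zeroʳ (A G i l)))) ≢0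

      -- The entries of `d i` sum to 0, but n δ₀ = K ab is not 0.
      opposite : ∃ λ l → i ≢ l × d i l ≡ - δ₀
      opposite =
        let l , ≢δ₀ = ¬∀⟶∃¬ n (λ l → d i l ≡ δ₀) (λ l → d i l ≟ℤ δ₀) ¬all
        in l , (λ i≡l → ≢δ₀ (cong (d i) (sym i≡l))) , d≡-δ₀ l ≢δ₀ (d-signs l)
        where
        ¬all : ¬ (∀ l → d i l ≡ δ₀)
        ¬all all = product-nonzero K≢0 ab≢0 (trans (sym n*δ₀) (trans (sym (Σ-const n δ₀)) (trans (Σ-cong n (λ l → sym (all l))) (Σ-d i))))
        d≡-δ₀ : ∀ l → d i l ≢ δ₀ → d i l ≡ δ₀ ⊎ d i l ≡ - δ₀ → d i l ≡ - δ₀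
        d≡-δ₀ l ≢δ₀ (inj₁ eq) = contradiction eq ≢δ₀
        d≡-δ₀ l _   (inj₂ eq) = eq

      walks-nonneg : ∀ l → + 0 ≤ walks l i
      walks-nonneg l = Σ-nonneg n nonneg
        where
        nonneg : ∀ t → + 0 ≤ A G l t * A G t i
        nonneg t with adj G l t
        ... | true  = subst (+ 0 ≤_) (sym (*-identityˡ (A G t i))) (A-nonneg G t i)
        ... | false = ≤-refl

      walks-bound : ∀ l → A G i l ≡ + 1 → walks l i ≤ + k - + 1
      walks-bound l i~l = 0≤i-j⇒j≤i (subst (+ 0 ≤_) total (Σ-nonneg n nonneg))
        where
        -- The summand is the indicator of the neighbours of `l` that are neither `i` nor adjacent
        -- to `i`.
        nonneg : ∀ t → + 0 ≤ A G l t + - + 1 * (A G l t * A G t i + + 1 * δ i t)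
        nonneg t with i ≟ t
        ... | yes refl = ≤-reflexive (sym (trans (cong₂ (λ a b → a + - + 1 * (a * b + + 1)) (trans (A-sym G l i) i~l) (A-loopless G i)) refl))
        ... | no _ with adj G l t | adj G t i
        ...   | true  | true  = ≤-refl
        ...   | true  | false = +≤+ ℕ.z≤n
        ...   | false | true  = ≤-refl
        ...   | false | false = ≤-refl
        total : Σℤ n (λ t → A G l t + - + 1 * (A G l t * A G t i + + 1 * δ i t)) ≡ + k - + 1 - walks l i
        total = begin
          Σℤ n (λ t → A G l t + - + 1 * (A G l t * A G t i + + 1 * δ i t))
            ≡⟨ Σ-linear n (- + 1) (A G l) (λ t → A G l t * A G t i + + 1 * δ i t) ⟩
          Σℤ n (A G l) + - + 1 * Σℤ n (λ t → A G l t * A G t i + + 1 * δ i t)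
            ≡⟨ cong₂ (λ x y → x + - + 1 * y) (regular l) (trans (Σ-linear n (+ 1) (λ t → A G l t * A G t i) (δ i)) (cong (λ x → walks l i + + 1 * x) (Σ-δ-one i))) ⟩
          + k + - + 1 * (walks l i + + 1)
            ≡⟨ shape (+ k) (walks l i) ⟩
          + k - + 1 - walks l i ∎
          where
          open ≡-Reasoning
          shape : ∀ k w → k + - + 1 * (w + + 1) ≡ k - + 1 - w
          shape = solve-∀

      d-entry : ∀ l → i ≢ l → d i l ≡ K * (walks l i - (α + β) * A G i l) - c
      d-entry l i≢l = trans (cong (λ x → K * x + - c * + 1) (C-entry i l))
        (trans (cong₂ (λ a x → K * (walks l i - (α + β) * a + α * β * x) + - c * + 1) (A-sym G l i) (δ-off (i≢l ∘ sym)))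
          (shape K (walks l i - (α + β) * A G i l) (α * β) c))
        where
        shape : ∀ K x p c → K * (x + p * + 0) + - c * + 1 ≡ K * x - c
        shape = solve-∀

      -- Equal entries of D at (i,l) and (i,i) mean equal entries of C, so the count minus α + β is
      -- k + αβ.
      walks-to-neighbour : ∀ l → A G i l ≡ + 1 → d i l ≡ δ₀ → walks l i ≡ + k - + 1 + ab
      walks-to-neighbour l i~l d≡δ₀ = i-j≡0⇒i≡j (walks l i) (+ k - + 1 + ab) (*-cancelˡ-zero K (walks l i - (+ k - + 1 + ab)) K≢0
        (trans (shape K (+ k) α β (walks l i) c) (i≡j⇒i-j≡0 (trans (sym entry) (trans d≡δ₀ δ₀-value)))))
        where
        i≢l : i ≢ l
        i≢l refl = contradiction (trans (sym i~l) (A-loopless G i)) λ ()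
        entry : d i l ≡ K * (walks l i - (α + β) * + 1) - c
        entry = trans (d-entry l i≢l) (cong (λ a → K * (walks l i - (α + β) * a) - c) i~l)
        shape : ∀ K k α β w c → K * (w - (k - + 1 + (+ 1 + α) * (+ 1 + β))) ≡ (K * (w - (α + β) * + 1) - c) - (K * (k + α * β) - c)
        shape = solve-∀

      -- The entries of D at (i,i) and (i,l) differ by 2δ₀, which is K times the difference of the
      -- entries of C. Multiply by n, use n δ₀ = K ab and cancel K.
      n∣2ab : ∀ l → i ≢ l → d i l ≡ - δ₀ → + 2 * ab ≡ + n * (+ k + α * β - (walks l i - (α + β) * A G i l))
      n∣2ab l i≢l d≡-δ₀ = i-j≡0⇒i≡j (+ 2 * ab) (+ n * (+ k + α * β - x)) (*-cancelˡ-zero K (+ 2 * ab - + n * (+ k + α * β - x)) K≢0 (begin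
        K * (+ 2 * ab - + n * (+ k + α * β - x))
          ≡⟨ shape K (+ n) (+ k + α * β) x c ab δ₀ ⟩
        - + 2 * (+ n * δ₀ - K * ab) + + n * ((δ₀ - (K * (+ k + α * β) - c)) + ((K * x - c) - - δ₀))
          ≡⟨ cong₂ (λ u w → - + 2 * u + + n * w) (i≡j⇒i-j≡0 n*δ₀)
               (cong₂ _+_ (i≡j⇒i-j≡0 δ₀-value) (i≡j⇒i-j≡0 (trans (sym (d-entry l i≢l)) d≡-δ₀))) ⟩
        + 0 + + n * + 0
          ≡⟨ trans (+-identityˡ _) (*-zeroʳ (+ n)) ⟩
        + 0 ∎))
        where
        open ≡-Reasoning
        x : ℤ
        x = walks l i - (α + β) * A G i l
        shape : ∀ K n p x c y z → K * (+ 2 * y - n * (p - x)) ≡ - + 2 * (n * z - K * y) + n * ((z - (K * p - c)) + ((K * x - c) - - z))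
        shape = solve-∀

      contradictory : 3 ℕ.≤ n → ⊥
      contradictory 3≤n =
        let l , i~l , d≡δ₀ = neighbour (degree-not-one n k α β 3≤n -1≢α -1≢β parameter-equation)
            l′ , i≢l′ , d≡-δ₀ = opposite
        in no-parameters n k α β (walks l i) _ parameter-equation ab≢0 k<n
             (walks-to-neighbour l i~l d≡δ₀) (walks-nonneg l) (walks-bound l i~l) (n∣2ab l′ i≢l′ d≡-δ₀)

theorem3p8 : (n k m : ℕ) (α β : ℤ) (G : Graph n) →
    + k ≢ - + 1 → + k ≢ α → + k ≢ β → - + 1 ≢ α → - + 1 ≢ β → α ≢ β →
    2 ℕ.≤ m → m ℕ.+ 4 ℕ.≤ n →
    Connected G → Regular k G →
    ¬ HasSpectrum G (+ k) α β m (n ℕ.∸ 2 ℕ.∸ m)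
theorem3p8 n k m α β G _ _ _ -1≢α -1≢β _ _ m+4≤n connected regular spectrum =
  let i , minor≢0 = simple-root-minor G k m (n ℕ.∸ 2 ℕ.∸ m) α β -1≢α -1≢β spectrum
  in contradictory G k m (n ℕ.∸ 2 ℕ.∸ m) α β -1≢α -1≢β spectrum connected regular i minor≢0
       (ℕ.≤-trans (ℕ.n≤1+n 3) (ℕ.≤-trans (ℕ.m≤n+m 4 m) m+4≤n))
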